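{- Let $\epsilon$ be a constant with $0<\epsilon<0.003$. There exist graphs $G$ with maximum degree $\Delta$ (for arbitrarily large $\Delta$) and minimum degree $\Delta^{1-\epsilon}$ such that $\chi_{CN}(G) = \Omega(\ln^2 \Delta)$.
   Context: A conflict-free closed neighborhood (CFCN) coloring of $G$ is an assignment of colors to $V(G)$ such that for every vertex $v$ some color appears exactly once in the closed neighborhood $N_G[v]=\{v\}\cup N_G(v)$; $\chi_{CN}(G)$ is the minimum number of colors in such a coloring. -}

module Defs where

open import Data.Nat using (ℕ; zero; suc; _+_; _*_; _∸_; _^_; _≤_; _<_; _⊔_)
open import Data.Bool using (Bool; true; false; if_then_else_; _∨_; _∧_)
open import Data.Fin using (Fin)
open import Data.Fin.Properties using () renaming (_≟_ to _≟ᶠ_)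
open import Data.List using (List; map; foldr; allFin)
open import Data.Nat.ListAction using (sum)
open import Data.Product using (Σ; ∃; _×_; _,_)
open import Relation.Nullary using (¬_)
open import Relation.Nullary.Decidable using (⌊_⌋)
open import Relation.Binary.PropositionalEquality using (_≡_)

record Graph (n : ℕ) : Set where
  field
    adj     : Fin n → Fin n → Bool
    sym     : ∀ u v → adj u v ≡ adj v u
    irrefl  : ∀ v → adj v v ≡ false
open Graph public

count : {n : ℕ} → (Fin n → Bool) → ℕ
count {n} P = sum (map (λ u → if P u then 1 else 0) (allFin n))

deg : {n : ℕ} → Graph n → Fin n → ℕ
deg G v = count (adj G v)

maxDeg : {n : ℕ} → Graph n → ℕ
maxDeg {n} G = foldr _⊔_ 0 (map (deg G) (allFin n))

inClosedNbhd : {n : ℕ} → Graph n → Fin n → Fin n → Bool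
inClosedNbhd G v u = ⌊ u ≟ᶠ v ⌋ ∨ adj G v u

IsCFCN : {n k : ℕ} → Graph n → (Fin n → Fin k) → Set
IsCFCN G c = ∀ v → ∃ λ j → count (λ u → inClosedNbhd G v u ∧ ⌊ c u ≟ᶠ j ⌋) ≡ 1

IsChiCN : {n : ℕ} → Graph n → ℕ → Set
IsChiCN {n} G k =
  (Σ (Fin n → Fin k) (IsCFCN G)) ×
  (∀ k' → k' < k → ¬ Σ (Fin n → Fin k') (IsCFCN G))

{-# OPTIONS --safe #-}
-- The graph is random with vertices on t ~ ln Δ levels: u and v are joined with
-- probability 2 ^ (d u + d v) / 2 ^ (2t − 1), where d u < t is the level of u.
-- For a vertex v of level d the number of neighbours in a colour class S has mean
-- x ~ 2 ^ d · W(S); it equals 1 with probability at most min (1/2, x, 2 / (1 + x)).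
-- As d varies x runs through a geometric progression, so the product over d of
-- the probabilities that v does not see S exactly once is at least 1/128. With
-- k = t ^ 2 classes, some level therefore has probability at least 128 ^ (− t),
-- a small power 1 / Δ ^ c, of seeing no class exactly once.
--
-- The vertices outside the support of a colouring fail independently, so all of
-- them succeed with tiny probability. A union bound over all colourings is too
-- expensive, but a class may be truncated to 3 · 2 ^ (2t − 1) vertices, since
-- already this part of a large class is likely to be seen at least twice. There
-- are few truncated colourings, and the union bound over these succeeds. The
-- minimum degree is controlled by a Chernoff bound.
--
-- Probabilities are expressed by counting: each vertex v carries a row r_v of
-- bit vectors, and u ~ v when r_u[v] and r_v[u] agree in a suffix.
module Submission where

open import Defs
open import Data.Nat using (ℕ; zero; suc; _+_; _*_; _∸_; _^_; _≤_; _<_; _⊔_; _≤ᵇ_; _/_; z≤n; s≤s; s≤s⁻¹; NonZero; >-nonZero; >-nonZero⁻¹)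
open import Data.Nat.Properties
open import Data.Nat.DivMod using (m≡m%n+[m/n]*n; m%n<n; m<n*o⇒m/o<n)
open import Data.Nat.ListAction using (sum)
open import Data.Nat.Logarithm using (⌊log₂_⌋; ⌊log₂⌋-mono-≤; ⌊log₂[2^n]⌋≡n)
open import Data.Nat.Tactic.RingSolver using (solve-∀)
open import Data.Bool using (Bool; true; false; if_then_else_; not; _∧_; _∨_; T)
open import Data.Bool.Properties using (∧-zeroʳ; ∧-identityʳ)
open import Data.Fin using (Fin; zero; suc; toℕ; _↑ˡ_; _↑ʳ_; inject≤; finToFun; funToFin; quotient)
open import Data.Fin.Properties using (any?; all?; toℕ<n; splitAt-↑ˡ; splitAt-↑ʳ; inject≤-injective; finToFun-funToFin)
  renaming (_≟_ to _≟ᶠ_; suc-injective to fsuc-injective)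
open import Data.List using (List; []; _∷_; _++_; map; foldr; length; allFin; cartesianProductWith)
open import Data.List.Properties using (map-tabulate)
open import Data.Vec using (Vec; []; _∷_; lookup; tabulate; replicate)
open import Data.Vec.Properties using (lookup∘tabulate)
open import Data.Product using (Σ; ∃; _×_; _,_; proj₁; proj₂)
open import Data.Sum using (_⊎_; inj₁; inj₂)
open import Function using (_∘_)
open import Relation.Nullary using (¬_; Dec; yes; no; contradiction)
open import Relation.Nullary.Decidable using (⌊_⌋; map′)
open import Relation.Binary.PropositionalEquality
  using (_≡_; refl; trans; cong; cong₂; subst; module ≡-Reasoning) renaming (sym to ≡-sym)

private variable
  α β : Set
  n : ℕ

-- Finite sums and products

⟦_⟧ : Bool → ℕ
⟦ b ⟧ = if b then 1 else 0

⟦⟧≤1 : ∀ b → ⟦ b ⟧ ≤ 1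
⟦⟧≤1 true  = ≤-refl
⟦⟧≤1 false = z≤n

∑ : List α → (α → ℕ) → ℕ
∑ xs f = sum (map f xs)

∑-cong : ∀ (xs : List α) {f g : α → ℕ} → (∀ x → f x ≡ g x) → ∑ xs f ≡ ∑ xs g
∑-cong []       h = refl
∑-cong (x ∷ xs) h = cong₂ _+_ (h x) (∑-cong xs h)

∑-mono : ∀ (xs : List α) {f g : α → ℕ} → (∀ x → f x ≤ g x) → ∑ xs f ≤ ∑ xs g
∑-mono []       h = z≤n
∑-mono (x ∷ xs) h = +-mono-≤ (h x) (∑-mono xs h)

+-interchange : ∀ a b c d → (a + b) + (c + d) ≡ (a + c) + (b + d)
+-interchange = solve-∀

∑-+ : ∀ (xs : List α) (f g : α → ℕ) → ∑ xs (λ x → f x + g x) ≡ ∑ xs f + ∑ xs g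
∑-+ []       f g = refl
∑-+ (x ∷ xs) f g = trans (cong (f x + g x +_) (∑-+ xs f g)) (+-interchange (f x) (g x) _ _)

∑-*ˡ : ∀ (xs : List α) c (f : α → ℕ) → ∑ xs (λ x → c * f x) ≡ c * ∑ xs f
∑-*ˡ []       c f = ≡-sym (*-zeroʳ c)
∑-*ˡ (x ∷ xs) c f = trans (cong (c * f x +_) (∑-*ˡ xs c f)) (≡-sym (*-distribˡ-+ c (f x) _))

∑-*ʳ : ∀ (xs : List α) (f : α → ℕ) c → ∑ xs (λ x → f x * c) ≡ ∑ xs f * c
∑-*ʳ xs f c = trans (∑-cong xs (λ x → *-comm (f x) c)) (trans (∑-*ˡ xs c f) (*-comm c _))

∑-const : ∀ (xs : List α) c → ∑ xs (λ _ → c) ≡ length xs * c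
∑-const []       c = refl
∑-const (x ∷ xs) c = cong (c +_) (∑-const xs c)

∑-zero : ∀ (xs : List α) → ∑ xs (λ _ → 0) ≡ 0
∑-zero xs = trans (∑-const xs 0) (*-zeroʳ (length xs))

∑-swap : ∀ (xs : List α) (ys : List β) (f : α → β → ℕ) →
  ∑ xs (λ x → ∑ ys (f x)) ≡ ∑ ys (λ y → ∑ xs (λ x → f x y))
∑-swap []       ys f = ≡-sym (∑-zero ys)
∑-swap (x ∷ xs) ys f =
  trans (cong (∑ ys (f x) +_) (∑-swap xs ys f)) (≡-sym (∑-+ ys (f x) (λ y → ∑ xs (λ z → f z y))))

∑-++ : ∀ (xs ys : List α) (f : α → ℕ) → ∑ (xs ++ ys) f ≡ ∑ xs f + ∑ ys f
∑-++ []       ys f = refl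
∑-++ (x ∷ xs) ys f = trans (cong (f x +_) (∑-++ xs ys f)) (≡-sym (+-assoc (f x) _ _))

∑-map : ∀ (h : α → β) (xs : List α) (f : β → ℕ) → ∑ (map h xs) f ≡ ∑ xs (f ∘ h)
∑-map h []       f = refl
∑-map h (x ∷ xs) f = cong (f (h x) +_) (∑-map h xs f)

-- The probabilistic method in counting form: `f` counts the bad events at each outcome, and an
-- average below one forces an outcome without any.
∑<length⇒∃0 : ∀ (xs : List α) (f : α → ℕ) → ∑ xs f < length xs → ∃ λ x → f x ≡ 0
∑<length⇒∃0 (x ∷ xs) f lt with f x in eq
... | zero  = x , eq
... | suc k = ∑<length⇒∃0 xs f (≤-trans (s≤s (m≤n+m _ k)) (s≤s⁻¹ lt))

vecs : List α → ∀ n → List (Vec α n)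
vecs xs zero    = [] ∷ []
vecs xs (suc n) = cartesianProductWith _∷_ xs (vecs xs n)

∑-product : ∀ {C : Set} (h : α → β → C) (xs : List α) (ys : List β) (f : C → ℕ) →
  ∑ (cartesianProductWith h xs ys) f ≡ ∑ xs (λ x → ∑ ys (λ y → f (h x y)))
∑-product h []       ys f = refl
∑-product h (x ∷ xs) ys f =
  trans (∑-++ (map (h x) ys) _ f) (cong₂ _+_ (∑-map (h x) ys f) (∑-product h xs ys f))

∑-vecs : ∀ (xs : List α) n (f : Vec α (suc n) → ℕ) →
  ∑ (vecs xs (suc n)) f ≡ ∑ xs (λ x → ∑ (vecs xs n) (λ v → f (x ∷ v)))
∑-vecs xs n f = ∑-product _∷_ xs (vecs xs n) f

length≡∑1 : ∀ (xs : List α) → length xs ≡ ∑ xs (λ _ → 1)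
length≡∑1 xs = ≡-sym (trans (∑-const xs 1) (*-identityʳ _))

length-vecs : ∀ (xs : List α) n → length (vecs xs n) ≡ length xs ^ n
length-vecs xs zero    = refl
length-vecs xs (suc n) =
  trans (length≡∑1 (vecs xs (suc n)))
  (trans (∑-vecs xs n _)
  (trans (∑-const xs _)
  (cong (length xs *_) (trans (≡-sym (length≡∑1 (vecs xs n))) (length-vecs xs n)))))

∑-allFin : ∀ n (f : Fin (suc n) → ℕ) → ∑ (allFin (suc n)) f ≡ f zero + ∑ (allFin n) (f ∘ suc)
∑-allFin n f = cong (f zero +_) (cong sum (trans (map-tabulate suc f) (≡-sym (map-tabulate (λ i → i) (f ∘ suc)))))

∑-allFin-const : ∀ n c → ∑ (allFin n) (λ _ → c) ≡ n * c
∑-allFin-const zero    c = refl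
∑-allFin-const (suc n) c = trans (∑-allFin n _) (cong (c +_) (∑-allFin-const n c))

∑-allFin-one : ∀ n → ∑ (allFin n) (λ _ → 1) ≡ n
∑-allFin-one n = trans (∑-allFin-const n 1) (*-identityʳ n)

term≤∑ : ∀ {n} (f : Fin n → ℕ) v → f v ≤ ∑ (allFin n) f
term≤∑ {suc n} f zero    = subst (f zero ≤_) (≡-sym (∑-allFin n f)) (m≤m+n _ _)
term≤∑ {suc n} f (suc v) = subst (f (suc v) ≤_) (≡-sym (∑-allFin n f)) (≤-trans (term≤∑ (f ∘ suc) v) (m≤n+m _ (f zero)))

count-cong : ∀ {n} {P R : Fin n → Bool} → (∀ u → P u ≡ R u) → count P ≡ count R
count-cong h = ∑-cong (allFin _) (λ u → cong ⟦_⟧ (h u))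

count-mono : ∀ {n} {P R : Fin n → Bool} → (∀ u → P u ≡ true → R u ≡ true) → count P ≤ count R
count-mono {n} {P} {R} h = ∑-mono (allFin n) λ u → lem (P u) (R u) (h u)
  where
  lem : ∀ p r → (p ≡ true → r ≡ true) → ⟦ p ⟧ ≤ ⟦ r ⟧
  lem false r h = z≤n
  lem true  r h rewrite h refl = ≤-refl

count-suc : ∀ {n} (P : Fin (suc n) → Bool) → count P ≡ ⟦ P zero ⟧ + count (P ∘ suc)
count-suc P = ∑-allFin _ (λ u → ⟦ P u ⟧)

∏ : ∀ {n} → (Fin n → ℕ) → ℕ
∏ {zero}  f = 1
∏ {suc n} f = f zero * ∏ (f ∘ suc)

∏-cong : ∀ {n} {f g : Fin n → ℕ} → (∀ i → f i ≡ g i) → ∏ f ≡ ∏ g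
∏-cong {zero}  h = refl
∏-cong {suc n} h = cong₂ _*_ (h zero) (∏-cong (h ∘ suc))

∏-mono : ∀ {n} {f g : Fin n → ℕ} → (∀ i → f i ≤ g i) → ∏ f ≤ ∏ g
∏-mono {zero}  h = ≤-refl
∏-mono {suc n} h = *-mono-≤ (h zero) (∏-mono (h ∘ suc))

∏-mono-< : ∀ {n} {f g : Fin (suc n) → ℕ} → (∀ i → f i < g i) → ∏ f < ∏ g
∏-mono-< {zero}  h = *-monoˡ-< 1 (h zero)
∏-mono-< {suc n} h = *-mono-< (h zero) (∏-mono-< (h ∘ suc))

*-interchange : ∀ a b c d → (a * b) * (c * d) ≡ (a * c) * (b * d)
*-interchange = solve-∀

∏-* : ∀ {n} (f g : Fin n → ℕ) → ∏ (λ i → f i * g i) ≡ ∏ f * ∏ g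
∏-* {zero}  f g = refl
∏-* {suc n} f g = trans (cong (f zero * g zero *_) (∏-* (f ∘ suc) (g ∘ suc))) (*-interchange (f zero) _ _ _)

∏-const : ∀ n c → ∏ {n} (λ _ → c) ≡ c ^ n
∏-const zero    c = refl
∏-const (suc n) c = cong (c *_) (∏-const n c)

∏-swap : ∀ {m n} (f : Fin m → Fin n → ℕ) → ∏ (λ i → ∏ (f i)) ≡ ∏ (λ j → ∏ (λ i → f i j))
∏-swap {zero}  {n} f = ≡-sym (trans (∏-const n 1) (^-zeroˡ n))
∏-swap {suc m} f = trans (cong (∏ (f zero) *_) (∏-swap (f ∘ suc))) (≡-sym (∏-* (f zero) _))

∏≡0⇒∃0 : ∀ {n} (f : Fin n → ℕ) → ∏ f ≡ 0 → ∃ λ i → f i ≡ 0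
∏≡0⇒∃0 {suc n} f e with m*n≡0⇒m≡0∨n≡0 (f zero) e
... | inj₁ e₀ = zero , e₀
... | inj₂ e₁ with ∏≡0⇒∃0 (f ∘ suc) e₁
... | i , eᵢ = suc i , eᵢ

∏≤1 : ∀ {n} (f : Fin n → ℕ) → (∀ i → f i ≤ 1) → ∏ f ≤ 1
∏≤1 {n} f h = ≤-trans (∏-mono h) (≤-reflexive (trans (∏-const n 1) (^-zeroˡ n)))

∏-if : ∀ {n} (act : Fin n → Bool) b h →
  ∏ (λ v → if act v then b else h) ≡ b ^ count act * h ^ count (not ∘ act)
∏-if {zero}  act b h = refl
∏-if {suc n} act b h rewrite count-suc act | count-suc (not ∘ act) | ∏-if (act ∘ suc) b h with act zero
... | true  = ≡-sym (*-assoc b (b ^ count (act ∘ suc)) _)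
... | false = lem h (b ^ count (act ∘ suc)) _
  where
  lem : ∀ x y z → x * (y * z) ≡ y * (x * z)
  lem = solve-∀

count-not : ∀ {n} (act : Fin n → Bool) → count act + count (not ∘ act) ≡ n
count-not {n} act = trans (≡-sym (∑-+ (allFin n) _ _)) (trans (∑-cong (allFin n) (λ v → lem (act v))) (∑-allFin-one n))
  where
  lem : ∀ b → ⟦ b ⟧ + ⟦ not b ⟧ ≡ 1
  lem true  = refl
  lem false = refl

-- Sums of independent indicators

-- Q ^ n times the expectation of φ (number of successes) over independent
-- trials with success probabilities b u / Q.
Z : ℕ → ∀ {n} → (Fin n → ℕ) → (ℕ → ℕ) → ℕ
Z Q {zero}  b φ = φ 0
Z Q {suc n} b φ = b zero * Z Q (b ∘ suc) (φ ∘ suc) + (Q ∸ b zero) * Z Q (b ∘ suc) φ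

-- The recursion makes shifting by `suc` definitional (`isOne ∘ suc` is `isZero`, `isOdd ∘ suc` is
-- `isEven`), so unfolding `Z` gives the recurrences used below.
isZero isOne isEven isOdd : ℕ → ℕ
isZero zero    = 1
isZero (suc c) = 0
isOne zero     = 0
isOne (suc c)  = isZero c
isEven zero    = 1
isEven (suc c) = isOdd c
isOdd zero     = 0
isOdd (suc c)  = isEven c

even+odd : ∀ c → isEven c + isOdd c ≡ 1
even+odd zero    = refl
even+odd (suc c) = trans (+-comm (isOdd c) _) (even+odd c)

isOne≤isOdd : ∀ c → isOne c ≤ isOdd c
isOne≤isOdd zero          = z≤n
isOne≤isOdd (suc zero)    = ≤-refl
isOne≤isOdd (suc (suc c)) = z≤n

Z-mono : ∀ Q {n} (b : Fin n → ℕ) {φ ψ : ℕ → ℕ} → (∀ c → φ c ≤ ψ c) → Z Q b φ ≤ Z Q b ψ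
Z-mono Q {zero}  b h = h 0
Z-mono Q {suc n} b h =
  +-mono-≤ (*-monoʳ-≤ (b zero) (Z-mono Q (b ∘ suc) (h ∘ suc))) (*-monoʳ-≤ (Q ∸ b zero) (Z-mono Q (b ∘ suc) h))

Z-cong : ∀ Q {n} {b b′ : Fin n → ℕ} (φ : ℕ → ℕ) → (∀ u → b u ≡ b′ u) → Z Q b φ ≡ Z Q b′ φ
Z-cong Q {zero}  φ h = refl
Z-cong Q {suc n} φ h rewrite h zero | Z-cong Q φ (h ∘ suc) | Z-cong Q (φ ∘ suc) (h ∘ suc) = refl

Z-+ : ∀ Q {n} (b : Fin n → ℕ) (φ ψ : ℕ → ℕ) → Z Q b (λ c → φ c + ψ c) ≡ Z Q b φ + Z Q b ψ
Z-+ Q {zero}  b φ ψ = refl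
Z-+ Q {suc n} b φ ψ rewrite Z-+ Q (b ∘ suc) φ ψ | Z-+ Q (b ∘ suc) (φ ∘ suc) (ψ ∘ suc) =
  lem (b zero) (Z Q (b ∘ suc) (φ ∘ suc)) (Z Q (b ∘ suc) (ψ ∘ suc)) (Q ∸ b zero) (Z Q (b ∘ suc) φ) (Z Q (b ∘ suc) ψ)
  where
  lem : ∀ x p q y r s → x * (p + q) + y * (r + s) ≡ (x * p + y * r) + (x * q + y * s)
  lem = solve-∀

Z-zero : ∀ Q {n} (b : Fin n → ℕ) → Z Q b (λ _ → 0) ≡ 0
Z-zero Q {zero}  b = refl
Z-zero Q {suc n} b rewrite Z-zero Q (b ∘ suc) | *-zeroʳ (b zero) = *-zeroʳ (Q ∸ b zero)

Z-one : ∀ Q {n} (b : Fin n → ℕ) → (∀ u → b u ≤ Q) → Z Q b (λ _ → 1) ≡ Q ^ n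
Z-one Q {zero}  b h = refl
Z-one Q {suc n} b h rewrite Z-one Q (b ∘ suc) (h ∘ suc) =
  trans (≡-sym (*-distribʳ-+ (Q ^ n) (b zero) _)) (cong (_* Q ^ n) (m+[n∸m]≡n (h zero)))

Z≤ : ∀ Q {n} (b : Fin n → ℕ) (φ : ℕ → ℕ) → (∀ u → b u ≤ Q) → (∀ c → φ c ≤ 1) → Z Q b φ ≤ Q ^ n
Z≤ Q b φ h h₁ = ≤-trans (Z-mono Q b h₁) (≤-reflexive (Z-one Q b h))

Z-complement : ∀ Q {n} (b : Fin n → ℕ) (φ ψ : ℕ → ℕ) → (∀ u → b u ≤ Q) → (∀ c → φ c + ψ c ≡ 1) →
  Z Q b φ + Z Q b ψ ≡ Q ^ n
Z-complement Q b φ ψ h e =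
  trans (≡-sym (Z-+ Q b φ ψ))
  (trans (≤-antisym (Z-mono Q b (≤-reflexive ∘ e)) (Z-mono Q b (≤-reflexive ∘ ≡-sym ∘ e))) (Z-one Q b h))

2*m≤n⇒m≤n : ∀ {b Q} → 2 * b ≤ Q → b ≤ Q
2*m≤n⇒m≤n {b} h = ≤-trans (m≤m+n b _) h

private
  odd-step : ∀ b c e o H → b ≤ c → e + o ≡ H → 2 * o ≤ H → 2 * (b * e + c * o) ≤ (b + c) * H
  odd-step b c e o H b≤c eq h with m≤n⇒∃[o]m+o≡n b≤c
  ... | f , refl = begin
    2 * (b * e + (b + f) * o)       ≡⟨ r₁ b e f o ⟩
    2 * b * (e + o) + f * (2 * o)   ≤⟨ +-mono-≤ (≤-reflexive (cong (2 * b *_) eq)) (*-monoʳ-≤ f h) ⟩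
    2 * b * H + f * H               ≡⟨ r₂ b f H ⟩
    (b + (b + f)) * H               ∎
    where
    open ≤-Reasoning
    r₁ : ∀ b e f o → 2 * (b * e + (b + f) * o) ≡ 2 * b * (e + o) + f * (2 * o)
    r₁ = solve-∀
    r₂ : ∀ b f H → 2 * b * H + f * H ≡ (b + (b + f)) * H
    r₂ = solve-∀

  one-step : ∀ b c z₀ z₁ H A → z₀ ≤ H → z₁ * (b + c) ≤ H * A →
    (b * z₀ + c * z₁) * (b + c) ≤ ((b + c) * H) * (b + A)
  one-step b c z₀ z₁ H A h₀ h₁ = begin
    (b * z₀ + c * z₁) * (b + c)              ≡⟨ r₁ b c z₀ z₁ ⟩
    b * (b + c) * z₀ + c * (z₁ * (b + c))    ≤⟨ +-mono-≤ (*-monoʳ-≤ (b * (b + c)) h₀) (*-mono-≤ (m≤n+m c b) h₁) ⟩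
    b * (b + c) * H + (b + c) * (H * A)      ≡⟨ r₂ b c H A ⟩
    ((b + c) * H) * (b + A)                  ∎
    where
    open ≤-Reasoning
    r₁ : ∀ b c z₀ z₁ → (b * z₀ + c * z₁) * (b + c) ≡ b * (b + c) * z₀ + c * (z₁ * (b + c))
    r₁ = solve-∀
    r₂ : ∀ b c H A → b * (b + c) * H + (b + c) * (H * A) ≡ ((b + c) * H) * (b + A)
    r₂ = solve-∀

  zero-step : ∀ b c z₀ H A → z₀ * ((b + c) + A) ≤ (b + c) * H →
    (c * z₀) * ((b + c) + (b + A)) ≤ (b + c) * ((b + c) * H)
  zero-step b c z₀ H A h = begin
    (c * z₀) * ((b + c) + (b + A))      ≤⟨ m≤m+n _ _ ⟩
    (c * z₀) * ((b + c) + (b + A)) + z₀ * b * (b + A) ≡⟨ r₁ b c z₀ A ⟩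
    (b + c) * (z₀ * ((b + c) + A))      ≤⟨ *-monoʳ-≤ (b + c) h ⟩
    (b + c) * ((b + c) * H)             ∎
    where
    open ≤-Reasoning
    r₁ : ∀ b c z₀ A → (c * z₀) * ((b + c) + (b + A)) + z₀ * b * (b + A) ≡ (b + c) * (z₀ * ((b + c) + A))
    r₁ = solve-∀

  -- Put p = b / (b + c) and x = A / (b + c). The induction yields p / (1 + x) + 2 (1 - p) / (1 + x)
  -- = (2 - p) / (1 + x), which is at most 2 / (1 + x + p) as soon as x + p ≥ 1. If x + p ≤ 1, the
  -- target is at least 1 and the trivial bound `triv` suffices.
  few-step : ∀ b c z₀ y H A → .{{NonZero (b + c)}} → b * z₀ + c * y ≤ (b + c) * H →
    z₀ * ((b + c) + A) ≤ (b + c) * H → y * ((b + c) + A) ≤ 2 * ((b + c) * H) →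
    (b * z₀ + c * y) * ((b + c) + (b + A)) ≤ 2 * ((b + c) * ((b + c) * H))
  few-step b c z₀ y H A triv h₀ h₁ with ≤-total (b + A) (b + c)
  ... | inj₁ le = begin
    (b * z₀ + c * y) * ((b + c) + (b + A))  ≤⟨ *-mono-≤ triv (+-monoʳ-≤ (b + c) le) ⟩
    ((b + c) * H) * ((b + c) + (b + c))     ≡⟨ r (b + c) H ⟩
    2 * ((b + c) * ((b + c) * H))           ∎
    where
    open ≤-Reasoning
    r : ∀ q H → (q * H) * (q + q) ≡ 2 * (q * (q * H))
    r = solve-∀
  ... | inj₂ ge = *-cancelʳ-≤ _ _ ((b + c) + A) (begin
    (b * z₀ + c * y) * (q + (b + A)) * (q + A)
      ≡⟨ r₁ b c z₀ y q A ⟩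
    (b * (z₀ * (q + A)) + c * (y * (q + A))) * (q + (b + A))
      ≤⟨ *-monoˡ-≤ (q + (b + A)) (+-mono-≤ (*-monoʳ-≤ b h₀) (*-monoʳ-≤ c h₁)) ⟩
    (b * (q * H) + c * (2 * (q * H))) * (q + (b + A))
      ≡⟨ r₂ b c (q * H) (q + (b + A)) ⟩
    (q * H) * ((b + 2 * c) * (q + (b + A)))
      ≤⟨ *-monoʳ-≤ (q * H) (begin
        (b + 2 * c) * (q + (b + A))           ≡⟨ r₃ b c A ⟩
        b * q + X                     ≤⟨ +-monoˡ-≤ X (*-monoʳ-≤ b ge) ⟩
        b * (b + A) + X               ≡⟨ r₄ b c A ⟩
        2 * q * (q + A)               ∎) ⟩
    (q * H) * (2 * q * (q + A))
      ≡⟨ r₅ q H (q + A) ⟩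
    2 * (q * (q * H)) * (q + A) ∎)
    where
    open ≤-Reasoning
    q = b + c
    X = 2 * c * q + (b + 2 * c) * (b + A)
    instance
      nz : NonZero (q + A)
      nz = m+n≢0 q A
        where
        m+n≢0 : ∀ m n → .{{NonZero m}} → NonZero (m + n)
        m+n≢0 (suc m) n = _
    r₁ : ∀ b c z₀ y q A → (b * z₀ + c * y) * (q + (b + A)) * (q + A) ≡
      (b * (z₀ * (q + A)) + c * (y * (q + A))) * (q + (b + A))
    r₁ = solve-∀
    r₂ : ∀ b c x y → (b * x + c * (2 * x)) * y ≡ x * ((b + 2 * c) * y)
    r₂ = solve-∀
    r₃ : ∀ b c A → (b + 2 * c) * ((b + c) + (b + A)) ≡ b * (b + c) + (2 * c * (b + c) + (b + 2 * c) * (b + A))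
    r₃ = solve-∀
    r₄ : ∀ b c A → b * (b + A) + (2 * c * (b + c) + (b + 2 * c) * (b + A)) ≡ 2 * (b + c) * ((b + c) + A)
    r₄ = solve-∀
    r₅ : ∀ q H w → (q * H) * (2 * q * w) ≡ 2 * (q * (q * H)) * w
    r₅ = solve-∀

  -- Trades the subtraction `Q ∸ b` for a variable `c`, so that the steps above become semiring
  -- identities.
  complement : ∀ b {Q} → 2 * b ≤ Q → ∃ λ c → (b + c ≡ Q) × (b ≤ c) × (Q ∸ b ≡ c)
  complement b h with m≤n⇒∃[o]m+o≡n h
  ... | f , refl = b + f , lem b f , m≤m+n b f , trans (cong (_∸ b) (≡-sym (lem b f))) (m+n∸m≡n b _)
    where
    lem : ∀ b f → b + (b + f) ≡ 2 * b + f
    lem = solve-∀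

-- Parity stands in for "exactly one" because a further trial merely flips it: 1 - 2 P(odd) is the
-- product of the 1 - 2p, and no factor is negative when each p ≤ 1/2.
2*Z-odd : ∀ Q {n} (b : Fin n → ℕ) → (∀ u → 2 * b u ≤ Q) → 2 * Z Q b isOdd ≤ Q ^ n
2*Z-odd Q {zero}  b h = z≤n
2*Z-odd Q {suc n} b h with complement (b zero) (h zero)
... | c , refl , b≤c , eq rewrite eq =
  odd-step (b zero) c _ _ (Q ^ n) b≤c
    (Z-complement Q (b ∘ suc) isEven isOdd (2*m≤n⇒m≤n ∘ h ∘ suc) even+odd) (2*Z-odd Q (b ∘ suc) (h ∘ suc))

2*Z-one : ∀ Q {n} (b : Fin n → ℕ) → (∀ u → 2 * b u ≤ Q) → 2 * Z Q b isOne ≤ Q ^ n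
2*Z-one Q b h = ≤-trans (*-monoʳ-≤ 2 (Z-mono Q b isOne≤isOdd)) (2*Z-odd Q b h)

isZero≤1 : ∀ c → isZero c ≤ 1
isZero≤1 zero    = ≤-refl
isZero≤1 (suc c) = z≤n

-- The probability of exactly one success is at most the expected number of successes.
Z-one-upper : ∀ Q {n} (b : Fin n → ℕ) → (∀ u → 2 * b u ≤ Q) →
  Z Q b isOne * Q ≤ Q ^ n * ∑ (allFin n) b
Z-one-upper Q {zero}  b h = z≤n
Z-one-upper Q {suc n} b h rewrite ∑-allFin n b with complement (b zero) (h zero)
... | c , refl , b≤c , eq rewrite eq =
  one-step (b zero) c _ _ (Q ^ n) (∑ (allFin n) (b ∘ suc))
    (Z≤ Q (b ∘ suc) isZero (2*m≤n⇒m≤n ∘ h ∘ suc) isZero≤1) (Z-one-upper Q (b ∘ suc) (h ∘ suc))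

-- The product of the 1 - p is at most 1 / (1 + x) with x the sum of the p, because (1 - p) (1 + x +
-- p) ≤ 1 + x.
Z-zero-tail : ∀ Q {n} (b : Fin n → ℕ) → (∀ u → 2 * b u ≤ Q) →
  Z Q b isZero * (Q + ∑ (allFin n) b) ≤ Q * Q ^ n
Z-zero-tail Q {zero}  b h = ≤-reflexive (trans (+-identityʳ _) (trans (+-identityʳ Q) (≡-sym (*-identityʳ Q))))
Z-zero-tail Q {suc n} b h rewrite ∑-allFin n b | Z-zero Q (b ∘ suc) | *-zeroʳ (b zero) with complement (b zero) (h zero)
... | c , refl , b≤c , eq rewrite eq =
  zero-step (b zero) c _ (Q ^ n) (∑ (allFin n) (b ∘ suc)) (Z-zero-tail Q (b ∘ suc) (h ∘ suc))

isFew : ℕ → ℕ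
isFew c = isZero c + isOne c

isFew≤1 : ∀ c → isFew c ≤ 1
isFew≤1 zero          = ≤-refl
isFew≤1 (suc zero)    = ≤-refl
isFew≤1 (suc (suc c)) = z≤n

Z-few-tail : ∀ Q {n} (b : Fin n → ℕ) → .{{NonZero Q}} → (∀ u → 2 * b u ≤ Q) →
  Z Q b isFew * (Q + ∑ (allFin n) b) ≤ 2 * (Q * Q ^ n)
Z-few-tail Q {zero}  b h = begin
  1 * (Q + 0)      ≡⟨ trans (+-identityʳ _) (+-identityʳ Q) ⟩
  Q                ≤⟨ m≤m+n Q _ ⟩
  2 * Q            ≡⟨ cong (2 *_) (≡-sym (*-identityʳ Q)) ⟩
  2 * (Q * 1)      ∎
  where open ≤-Reasoning
Z-few-tail Q {suc n} b h rewrite ∑-allFin n b =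
  at (b zero) (Q ∸ b zero) (Z Q (b ∘ suc) isZero) (Z Q (b ∘ suc) isFew) (∑ (allFin n) (b ∘ suc))
    (m+[n∸m]≡n (2*m≤n⇒m≤n {b zero} (h zero))) (Z≤ Q b isFew (2*m≤n⇒m≤n ∘ h) isFew≤1)
    (Z-zero-tail Q (b ∘ suc) (h ∘ suc)) (Z-few-tail Q (b ∘ suc) (h ∘ suc))
  where
  at : ∀ {Q H} b c z₀ y A → .{{NonZero Q}} → b + c ≡ Q → b * z₀ + c * y ≤ Q * H →
    z₀ * (Q + A) ≤ Q * H → y * (Q + A) ≤ 2 * (Q * H) →
    (b * z₀ + c * y) * (Q + (b + A)) ≤ 2 * (Q * (Q * H))
  at {H = H} b c z₀ y A refl = few-step b c z₀ y H A

-- Geometric progressions of scales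

-- With x = A / Q, this says 1 − γ / H ≤ min (1/2, x, 2 / (1 + x)).
record Avoids (Q H A γ : ℕ) : Set where
  field
    γ≤H   : γ ≤ H
    half  : H ≤ 2 * γ
    small : H * Q ≤ γ * Q + H * A
    large : H * (Q + A) ≤ γ * (Q + A) + 2 * (Q * H)

∏ℕ : ℕ → (ℕ → ℕ) → ℕ
∏ℕ m Γ = ∏ {m} (Γ ∘ toℕ)

module _ (Q H : ℕ) {{_ : NonZero Q}} where
  open ≤-Reasoning

  private
    Scales : ℕ → (ℕ → ℕ) → (ℕ → ℕ) → Set
    Scales m A Γ = (∀ {d} → d < m → Avoids Q H (A d) (Γ d)) × (∀ d → A (suc d) ≡ 2 * A d)

    next : ∀ {m A Γ} → Scales (suc m) A Γ → Scales m (A ∘ suc) (Γ ∘ suc)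
    next (h , e) = h ∘ s≤s , e ∘ suc

  -- A union bound over the scales: the defect at scale `d` is at most 2Q / A d, and these sum
  -- geometrically to at most 4Q / A 0.
  large-scales : ∀ m {A Γ} → Scales m A Γ → H ^ m * A 0 ≤ ∏ℕ m Γ * A 0 + 4 * Q * H ^ m
  large-scales zero    {A} h = m≤m+n _ _
  -- The defect `H * Hm - γ * P` splits as `(H - γ) * Hm + γ * (Hm - P)`. The term `γ * Hm * A 0` is
  -- added to both sides to avoid subtraction.
  large-scales (suc m) {A} {Γ} s@(h , e) = +-cancelʳ-≤ (γ * Hm * A 0) _ _ (begin
    H * Hm * A 0 + γ * Hm * A 0
      ≡⟨ r₁ H Hm (A 0) γ ⟩
    H * A 0 * Hm + γ * (Hm * A 0)
      ≤⟨ +-mono-≤ (*-monoˡ-≤ Hm now) (*-monoʳ-≤ γ ih) ⟩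
    (γ * A 0 + 2 * (Q * H)) * Hm + γ * (P * A 0 + 2 * Q * Hm)
      ≡⟨ r₂ γ (A 0) Q H Hm P ⟩
    (γ * P * A 0 + 2 * (Q * H) * Hm + γ * Hm * A 0) + γ * (2 * Q * Hm)
      ≤⟨ +-monoʳ-≤ (γ * P * A 0 + 2 * (Q * H) * Hm + γ * Hm * A 0) (*-monoˡ-≤ (2 * Q * Hm) (Avoids.γ≤H (h 0<1+n))) ⟩
    (γ * P * A 0 + 2 * (Q * H) * Hm + γ * Hm * A 0) + H * (2 * Q * Hm)
      ≡⟨ r₃ γ (A 0) Q H Hm P ⟩
    (γ * P * A 0 + 4 * Q * (H * Hm)) + γ * Hm * A 0 ∎)
    where
    γ = Γ 0
    Hm = H ^ m
    P = ∏ℕ m (Γ ∘ suc)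
    now : H * A 0 ≤ γ * A 0 + 2 * (Q * H)
    now = +-cancelˡ-≤ (H * Q) _ _ (begin
      H * Q + H * A 0                      ≡⟨ ≡-sym (*-distribˡ-+ H Q (A 0)) ⟩
      H * (Q + A 0)                        ≤⟨ Avoids.large (h 0<1+n) ⟩
      γ * (Q + A 0) + 2 * (Q * H)          ≡⟨ t γ Q (A 0) (2 * (Q * H)) ⟩
      γ * Q + (γ * A 0 + 2 * (Q * H))      ≤⟨ +-monoˡ-≤ _ (*-monoˡ-≤ Q (Avoids.γ≤H (h 0<1+n))) ⟩
      H * Q + (γ * A 0 + 2 * (Q * H))      ∎)
      where
      t : ∀ γ Q A y → γ * (Q + A) + y ≡ γ * Q + (γ * A + y)
      t = solve-∀
    -- The tail starts at `A 1 = 2 * A 0`; dividing by 2 turns its error `4 * Q` into `2 * Q`,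
    -- leaving the other half for the present scale.
    ih : Hm * A 0 ≤ P * A 0 + 2 * Q * Hm
    ih = *-cancelˡ-≤ 2 (begin
      2 * (Hm * A 0)             ≡⟨ t₁ Hm (A 0) ⟩
      Hm * (2 * A 0)             ≡⟨ cong (Hm *_) (≡-sym (e 0)) ⟩
      Hm * A 1                   ≤⟨ large-scales m (next s) ⟩
      P * A 1 + 4 * Q * Hm       ≡⟨ cong (λ x → P * x + 4 * Q * Hm) (e 0) ⟩
      P * (2 * A 0) + 4 * Q * Hm ≡⟨ t₂ P (A 0) Q Hm ⟩
      2 * (P * A 0 + 2 * Q * Hm) ∎)
      where
      t₁ : ∀ x y → 2 * (x * y) ≡ x * (2 * y)
      t₁ = solve-∀
      t₂ : ∀ P A Q Hm → P * (2 * A) + 4 * Q * Hm ≡ 2 * (P * A + 2 * Q * Hm)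
      t₂ = solve-∀
    r₁ : ∀ H Hm A γ → H * Hm * A + γ * Hm * A ≡ H * A * Hm + γ * (Hm * A)
    r₁ = solve-∀
    r₂ : ∀ γ A Q H Hm P → (γ * A + 2 * (Q * H)) * Hm + γ * (P * A + 2 * Q * Hm) ≡
      (γ * P * A + 2 * (Q * H) * Hm + γ * Hm * A) + γ * (2 * Q * Hm)
    r₂ = solve-∀
    r₃ : ∀ γ A Q H Hm P → (γ * P * A + 2 * (Q * H) * Hm + γ * Hm * A) + H * (2 * Q * Hm) ≡
      (γ * P * A + 4 * Q * (H * Hm)) + γ * Hm * A
    r₃ = solve-∀

  -- After `c` doublings the progression is past `8 * Q`, where `large-scales` loses at most a
  -- factor 2. Each of the `c` scales before loses at most a factor 2 by `half`.
  middle-scales : ∀ c m {A Γ} → Scales m A Γ → 8 * Q ≤ 2 ^ c * A 0 → H ^ m ≤ 2 ^ suc c * ∏ℕ m Γ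
  middle-scales zero m {A} {Γ} s 8Q≤A = *-cancelʳ-≤ (H ^ m) (2 * P) (A 0) {{A≢0}} (+-cancelʳ-≤ (H ^ m * A 0) _ _ (begin
    H ^ m * A 0 + H ^ m * A 0           ≤⟨ +-mono-≤ (large-scales m s) (large-scales m s) ⟩
    (P * A 0 + 4 * Q * H ^ m) + (P * A 0 + 4 * Q * H ^ m) ≡⟨ r P (A 0) Q (H ^ m) ⟩
    2 * P * A 0 + H ^ m * (8 * Q)       ≤⟨ +-monoʳ-≤ (2 * P * A 0) (*-monoʳ-≤ (H ^ m) A-large) ⟩
    2 * P * A 0 + H ^ m * A 0           ∎))
    where
    P = ∏ℕ m Γ
    A-large : 8 * Q ≤ A 0
    A-large = ≤-trans 8Q≤A (≤-reflexive (+-identityʳ (A 0)))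
    A≢0 : NonZero (A 0)
    A≢0 = >-nonZero (≤-trans (>-nonZero⁻¹ Q) (≤-trans (m≤m+n Q _) A-large))
    r : ∀ P A Q x → (P * A + 4 * Q * x) + (P * A + 4 * Q * x) ≡ 2 * P * A + x * (8 * Q)
    r = solve-∀
  middle-scales (suc c) zero {A} s h = ≤-trans (m^n>0 2 (suc (suc c))) (≤-reflexive (≡-sym (*-identityʳ _)))
  middle-scales (suc c) (suc m) {A} {Γ} s@(a , e) h = begin
    H * H ^ m                          ≤⟨ *-mono-≤ (Avoids.half (a 0<1+n)) (middle-scales c m (next s) h′) ⟩
    (2 * Γ 0) * (2 ^ suc c * P)        ≡⟨ *-interchange 2 (Γ 0) (2 ^ suc c) P ⟩
    2 ^ suc (suc c) * (Γ 0 * P)        ∎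
    where
    P = ∏ℕ m (Γ ∘ suc)
    h′ : 8 * Q ≤ 2 ^ c * A 1
    h′ = begin
      8 * Q             ≤⟨ h ⟩
      2 * 2 ^ c * A 0   ≡⟨ t (2 ^ c) (A 0) ⟩
      2 ^ c * (2 * A 0) ≡⟨ cong (2 ^ c *_) (≡-sym (e 0)) ⟩
      2 ^ c * A 1       ∎
      where
      t : ∀ x y → 2 * x * y ≡ x * (2 * y)
      t = solve-∀

  private
    -- Five doublings lead from 1/4 to 8, hence the constant 2 ^ 6 = 64.
    from-quarter : ∀ m {A Γ} → Scales m A Γ → Q ≤ 4 * A 0 → H ^ m ≤ 64 * ∏ℕ m Γ
    from-quarter m {A} s h = middle-scales 5 m s
      (≤-trans (*-monoʳ-≤ 8 h) (≤-reflexive (≡-sym (*-assoc 8 4 (A 0)))))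

  -- The factor 1 + 2x, with x = A 0 / Q, strengthens the induction: for x ≤ 1/4 one scale loses 1 -
  -- x, and (1 - x) (1 + 4x) ≥ 1 + 2x hands the factor on to 2x. Once x ≥ 1/4, `from-quarter`
  -- applies and the factor is at most 2, whence 128.
  small-scales : ∀ m {A Γ} → Scales m A Γ → 2 * A 0 ≤ Q → H ^ m * (Q + 2 * A 0) ≤ 128 * Q * ∏ℕ m Γ
  small-scales zero {A} s h = begin
    1 * (Q + 2 * A 0)   ≡⟨ +-identityʳ _ ⟩
    Q + 2 * A 0         ≤⟨ +-monoʳ-≤ Q h ⟩
    Q + Q               ≤⟨ m≤m+n (Q + Q) (126 * Q) ⟩
    Q + Q + 126 * Q     ≡⟨ r Q ⟩
    128 * Q * 1         ∎
    where
    r : ∀ Q → Q + Q + 126 * Q ≡ 128 * Q * 1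
    r = solve-∀
  small-scales (suc m) {A} {Γ} s@(a , e) h with ≤-total Q (4 * A 0)
  ... | inj₁ Q≤4A = begin
    H ^ suc m * (Q + 2 * A 0)     ≤⟨ *-mono-≤ (from-quarter (suc m) s Q≤4A) (+-monoʳ-≤ Q h) ⟩
    64 * P * (Q + Q)              ≡⟨ r P Q ⟩
    128 * Q * P                   ∎
    where
    P = ∏ℕ (suc m) Γ
    r : ∀ P Q → 64 * P * (Q + Q) ≡ 128 * Q * P
    r = solve-∀
  ... | inj₂ 4A≤Q = begin
    H * Hm * (Q + 2 * A 0)        ≡⟨ r₁ H Hm (Q + 2 * A 0) ⟩
    Hm * (H * (Q + 2 * A 0))      ≤⟨ *-monoʳ-≤ Hm (now (m≤n⇒∃[o]m+o≡n 4A≤Q)) ⟩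
    Hm * (γ * (Q + 4 * A 0))      ≡⟨ r₂ Hm γ Q (A 0) ⟩
    γ * (Hm * (Q + 2 * (2 * A 0))) ≡⟨ cong (λ x → γ * (Hm * (Q + 2 * x))) (≡-sym (e 0)) ⟩
    γ * (Hm * (Q + 2 * A 1))      ≤⟨ *-monoʳ-≤ γ (small-scales m (next s) 2A₁≤Q) ⟩
    γ * (128 * Q * P)             ≡⟨ r₃ γ (128 * Q) P ⟩
    128 * Q * (γ * P)             ∎
    where
    γ = Γ 0
    Hm = H ^ m
    P = ∏ℕ m (Γ ∘ suc)
    2A₁≤Q : 2 * A 1 ≤ Q
    2A₁≤Q = ≤-trans (≤-reflexive (trans (cong (2 *_) (e 0)) (≡-sym (*-assoc 2 2 (A 0))))) 4A≤Q
    -- Writing `Q = 4 * x + o` encodes x / Q ≤ 1/4; the slack `H * (x * o)` is what the quadratic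
    -- inequality leaves over.
    now : ∃ (λ o → 4 * A 0 + o ≡ Q) → H * (Q + 2 * A 0) ≤ γ * (Q + 4 * A 0)
    now (o , eq) = *-cancelʳ-≤ _ _ Q (begin
      H * (Q + 2 * x) * Q                       ≡⟨ cong (λ q → H * (q + 2 * x) * q) (≡-sym eq) ⟩
      H * ((4 * x + o) + 2 * x) * (4 * x + o)   ≤⟨ m≤m+n _ _ ⟩
      H * ((4 * x + o) + 2 * x) * (4 * x + o) + H * (x * o) ≡⟨ t₁ H x o ⟩
      H * (3 * x + o) * (4 * x + o + 4 * x)     ≤⟨ *-monoˡ-≤ (4 * x + o + 4 * x) hit ⟩
      γ * (4 * x + o) * (4 * x + o + 4 * x)     ≡⟨ cong (λ q → γ * q * (q + 4 * x)) eq ⟩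
      γ * Q * (Q + 4 * x)                       ≡⟨ t₂ γ Q (Q + 4 * x) ⟩
      γ * (Q + 4 * x) * Q                       ∎)
      where
      x = A 0
      hit : H * (3 * x + o) ≤ γ * (4 * x + o)
      hit = +-cancelʳ-≤ (H * x) _ _ (begin
        H * (3 * x + o) + H * x     ≡⟨ t H x o ⟩
        H * (4 * x + o)             ≤⟨ subst (λ q → H * q ≤ γ * q + H * x) (≡-sym eq) (Avoids.small (a 0<1+n)) ⟩
        γ * (4 * x + o) + H * x     ∎)
        where
        t : ∀ H x o → H * (3 * x + o) + H * x ≡ H * (4 * x + o)
        t = solve-∀
      t₁ : ∀ H x o → H * ((4 * x + o) + 2 * x) * (4 * x + o) + H * (x * o) ≡ H * (3 * x + o) * (4 * x + o + 4 * x)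
      t₁ = solve-∀
      t₂ : ∀ γ Q y → γ * Q * y ≡ γ * y * Q
      t₂ = solve-∀
    r₁ : ∀ H Hm y → H * Hm * y ≡ Hm * (H * y)
    r₁ = solve-∀
    r₂ : ∀ Hm γ Q A → Hm * (γ * (Q + 4 * A)) ≡ γ * (Hm * (Q + 2 * (2 * A)))
    r₂ = solve-∀
    r₃ : ∀ γ x P → γ * (x * P) ≡ x * (γ * P)
    r₃ = solve-∀

  all-scales : ∀ m {A Γ} → (∀ {d} → d < m → Avoids Q H (A d) (Γ d)) → (∀ d → A (suc d) ≡ 2 * A d) →
    H ^ m ≤ 128 * ∏ℕ m Γ
  all-scales m {A} {Γ} h e with ≤-total (2 * A 0) Q
  ... | inj₁ 2A≤Q = *-cancelʳ-≤ _ _ Q (begin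
    H ^ m * Q              ≤⟨ *-monoʳ-≤ (H ^ m) (m≤m+n Q _) ⟩
    H ^ m * (Q + 2 * A 0)  ≤⟨ small-scales m s 2A≤Q ⟩
    128 * Q * ∏ℕ m Γ       ≡⟨ r Q (∏ℕ m Γ) ⟩
    128 * ∏ℕ m Γ * Q       ∎)
    where
    s : Scales m A Γ
    s = h , e
    r : ∀ Q P → 128 * Q * P ≡ 128 * P * Q
    r = solve-∀
  ... | inj₂ Q≤2A = ≤-trans (from-quarter m s (≤-trans Q≤2A (*-monoˡ-≤ (A 0) (s≤s (s≤s (z≤n {2}))))))
    (*-monoˡ-≤ (∏ℕ m Γ) (m≤m+n 64 64))
    where
    s : Scales m A Γ
    s = h , e

-- Independence

∑-not : ∀ (xs : List α) (P : α → Bool) → ∑ xs (⟦_⟧ ∘ not ∘ P) ≡ length xs ∸ ∑ xs (⟦_⟧ ∘ P)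
∑-not xs P = m+n≡o⇒n≡o∸m (trans (≡-sym (∑-+ xs (⟦_⟧ ∘ P) (⟦_⟧ ∘ not ∘ P)))
  (trans (∑-cong xs (λ x → one (P x))) (≡-sym (length≡∑1 xs))))
  where
  one : ∀ b → ⟦ b ⟧ + ⟦ not b ⟧ ≡ 1
  one true  = refl
  one false = refl
  m+n≡o⇒n≡o∸m : ∀ {m n o} → m + n ≡ o → n ≡ o ∸ m
  m+n≡o⇒n≡o∸m {m} {n} refl = ≡-sym (m+n∸m≡n m n)

-- The bridge from counting rows to `Z`: coordinates of a uniform row are independent, and `u`
-- succeeds for `∑ xs (⟦_⟧ ∘ F u)` of the `length xs` letters.
∑-vecs-count : ∀ (xs : List α) n (F : Fin n → α → Bool) (φ : ℕ → ℕ) →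
  ∑ (vecs xs n) (λ r → φ (count (λ u → F u (lookup r u)))) ≡
  Z (length xs) (λ u → ∑ xs (⟦_⟧ ∘ F u)) φ
∑-vecs-count xs zero    F φ = +-identityʳ _
∑-vecs-count {α = α} xs (suc n) F φ = begin
  ∑ (vecs xs (suc n)) (λ r → φ (count (λ u → F u (lookup r u))))
    ≡⟨ ∑-vecs xs n _ ⟩
  ∑ xs (λ x → ∑ (vecs xs n) (λ r → φ (count (λ u → F u (lookup (x ∷ r) u)))))
    ≡⟨ ∑-cong xs (λ x → trans (∑-cong (vecs xs n) (λ r → cong φ (count-suc (λ u → F u (lookup (x ∷ r) u))))) (split x)) ⟩
  ∑ xs (λ x → ⟦ F zero x ⟧ * hit + ⟦ not (F zero x) ⟧ * miss)
    ≡⟨ ∑-+ xs _ _ ⟩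
  ∑ xs (λ x → ⟦ F zero x ⟧ * hit) + ∑ xs (λ x → ⟦ not (F zero x) ⟧ * miss)
    ≡⟨ cong₂ _+_ (∑-*ʳ xs _ hit) (trans (∑-*ʳ xs _ miss) (cong (_* miss) (∑-not xs (F zero)))) ⟩
  Z (length xs) (λ u → ∑ xs (⟦_⟧ ∘ F u)) φ ∎
  where
  open ≡-Reasoning
  b : Fin n → ℕ
  b u = ∑ xs (⟦_⟧ ∘ F (suc u))
  hit = Z (length xs) b (φ ∘ suc)
  miss = Z (length xs) b φ
  split : ∀ x → ∑ (vecs xs n) (λ r → φ (⟦ F zero x ⟧ + count (λ u → F (suc u) (lookup r u)))) ≡
    ⟦ F zero x ⟧ * hit + ⟦ not (F zero x) ⟧ * miss
  split x with F zero x
  ... | true  = trans (∑-vecs-count xs n (F ∘ suc) (φ ∘ suc)) (≡-sym (trans (+-identityʳ _) (+-identityʳ _)))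
  ... | false = trans (∑-vecs-count xs n (F ∘ suc) φ) (≡-sym (+-identityʳ _))

DependsOn : (Fin n → Bool) → (Vec α n → β) → Set
DependsOn P f = ∀ r r′ → (∀ u → P u ≡ true → lookup r u ≡ lookup r′ u) → f r ≡ f r′

dependsOn-tail : ∀ (P : Fin (suc n) → Bool) {f : Vec α (suc n) → β} → DependsOn P f →
  ∀ x → DependsOn (P ∘ suc) (λ r → f (x ∷ r))
dependsOn-tail P h x r r′ agree = h (x ∷ r) (x ∷ r′) λ { zero _ → refl ; (suc u) → agree u }

dependsOn-head : ∀ (P : Fin (suc n) → Bool) {f : Vec α (suc n) → β} → DependsOn P f → P zero ≡ false →
  ∀ x y r → f (x ∷ r) ≡ f (y ∷ r)
dependsOn-head P h P₀ x y r = h (x ∷ r) (y ∷ r) λ { zero P₀′ → contradiction (trans (≡-sym P₀) P₀′) λ () ; (suc u) _ → refl }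

private
  independent-step : ∀ (xs : List α) n (f g : Vec α (suc n) → ℕ) →
    (∀ x y r → g (x ∷ r) ≡ g (y ∷ r)) →
    (∀ x → ∑ (vecs xs n) (λ r → f (x ∷ r) * g (x ∷ r)) * length xs ^ n ≡
           ∑ (vecs xs n) (λ r → f (x ∷ r)) * ∑ (vecs xs n) (λ r → g (x ∷ r))) →
    ∑ (vecs xs (suc n)) (λ r → f r * g r) * length xs ^ suc n ≡ ∑ (vecs xs (suc n)) f * ∑ (vecs xs (suc n)) g
  independent-step xs n f g free ih = begin
    ∑ (vecs xs (suc n)) (λ r → f r * g r) * (L * L ^ n)
      ≡⟨ cong (_* (L * L ^ n)) (∑-vecs xs n _) ⟩
    ∑ xs FG * (L * L ^ n)
      ≡⟨ ≡-sym (∑-*ʳ xs FG _) ⟩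
    ∑ xs (λ x → FG x * (L * L ^ n))
      ≡⟨ ∑-cong xs (λ x → trans (r₁ (FG x) L (L ^ n)) (trans (cong (L *_) (ih x)) (r₂ L (F x) (G x)))) ⟩
    ∑ xs (λ x → F x * (L * G x))
      ≡⟨ ∑-cong xs (λ x → cong (F x *_) (trans (≡-sym (∑-const xs (G x)))
           (∑-cong xs (λ y → ∑-cong (vecs xs n) (free x y))))) ⟩
    ∑ xs (λ x → F x * ∑ xs G)
      ≡⟨ ∑-*ʳ xs F _ ⟩
    ∑ xs F * ∑ xs G
      ≡⟨ ≡-sym (cong₂ _*_ (∑-vecs xs n f) (∑-vecs xs n g)) ⟩
    ∑ (vecs xs (suc n)) f * ∑ (vecs xs (suc n)) g ∎
    where
    open ≡-Reasoning
    L = length xs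
    F G FG : _ → ℕ
    F x = ∑ (vecs xs n) (λ r → f (x ∷ r))
    G x = ∑ (vecs xs n) (λ r → g (x ∷ r))
    FG x = ∑ (vecs xs n) (λ r → f (x ∷ r) * g (x ∷ r))
    r₁ : ∀ a b c → a * (b * c) ≡ b * (a * c)
    r₁ = solve-∀
    r₂ : ∀ a b c → a * (b * c) ≡ b * (a * c)
    r₂ = solve-∀

-- The product rule for expectations, cleared of denominators. Each coordinate is ignored by `f` or
-- by `g`; `independent-step` treats the case of `g`, and commutativity reduces the other case to
-- it.
∑-independent : ∀ (xs : List α) n (P : Fin n → Bool) (f g : Vec α n → ℕ) →
  DependsOn P f → DependsOn (not ∘ P) g →
  ∑ (vecs xs n) (λ r → f r * g r) * length xs ^ n ≡ ∑ (vecs xs n) f * ∑ (vecs xs n) g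
∑-independent xs zero P f g hf hg = lem (f []) (g [])
  where
  lem : ∀ x y → (x * y + 0) * 1 ≡ (x + 0) * (y + 0)
  lem = solve-∀
∑-independent xs (suc n) P f g hf hg with P zero in P₀
... | true  = independent-step xs n f g (dependsOn-head (not ∘ P) hg (cong not P₀))
  λ x → ∑-independent xs n (P ∘ suc) _ _ (dependsOn-tail P hf x) (dependsOn-tail (not ∘ P) hg x)
... | false = trans (cong (_* length xs ^ suc n) (∑-cong (vecs xs (suc n)) (λ r → *-comm (f r) (g r))))
  (trans (independent-step xs n g f (dependsOn-head P hf P₀)
    λ x → trans (cong (_* length xs ^ n) (∑-cong (vecs xs n) (λ r → *-comm (g (x ∷ r)) (f (x ∷ r)))))
      (trans (∑-independent xs n (P ∘ suc) _ _ (dependsOn-tail P hf x) (dependsOn-tail (not ∘ P) hg x))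
        (*-comm (∑ (vecs xs n) (λ r → f (x ∷ r))) _)))
    (*-comm (∑ (vecs xs (suc n)) g) _))

dependsOn-weaken : ∀ {P P′ : Fin n → Bool} {f : Vec α n → β} → (∀ u → P u ≡ true → P′ u ≡ true) →
  DependsOn P f → DependsOn P′ f
dependsOn-weaken w h r r′ agree = h r r′ λ u Pu → agree u (w u Pu)

dependsOn-∏ : ∀ {k} {P : Fin n → Bool} {g : Fin k → Vec α n → ℕ} → (∀ j → DependsOn P (g j)) →
  DependsOn P (λ r → ∏ (λ j → g j r))
dependsOn-∏ h r r′ agree = ∏-cong λ j → h j r r′ agree

-- Factors are split off one at a time: by disjointness the remaining ones read only coordinates
-- outside `P zero`.
∑-∏-independent : ∀ (xs : List α) n k (P : Fin k → Fin n → Bool) (g : Fin k → Vec α n → ℕ) →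
  (∀ i j u → P i u ≡ true → P j u ≡ true → i ≡ j) → (∀ j → DependsOn (P j) (g j)) →
  ∑ (vecs xs n) (λ r → ∏ (λ j → g j r)) * (length xs ^ n) ^ k ≡
  length xs ^ n * ∏ (λ j → ∑ (vecs xs n) (g j))
∑-∏-independent xs n zero P g disj h = begin
  ∑ (vecs xs n) (λ _ → 1) * 1   ≡⟨ cong (_* 1) (≡-sym (length≡∑1 (vecs xs n))) ⟩
  length (vecs xs n) * 1        ≡⟨ cong (_* 1) (length-vecs xs n) ⟩
  length xs ^ n * 1             ∎
  where open ≡-Reasoning
∑-∏-independent {α = α} xs n (suc k) P g disj h = begin
  ∑ V (λ r → g zero r * rest r) * (H * H ^ k)   ≡⟨ ≡-sym (*-assoc (∑ V (λ r → g zero r * rest r)) H (H ^ k)) ⟩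
  ∑ V (λ r → g zero r * rest r) * H * H ^ k     ≡⟨ cong (_* H ^ k) (∑-independent xs n (P zero) (g zero) rest (h zero) rest-dep) ⟩
  ∑ V (g zero) * ∑ V rest * H ^ k               ≡⟨ *-assoc (∑ V (g zero)) _ _ ⟩
  ∑ V (g zero) * (∑ V rest * H ^ k)             ≡⟨ cong (∑ V (g zero) *_)
    (∑-∏-independent xs n k (P ∘ suc) (g ∘ suc) (λ i j u p q → fsuc-injective (disj (suc i) (suc j) u p q)) (h ∘ suc)) ⟩
  ∑ V (g zero) * (H * ∏ (λ j → ∑ V (g (suc j)))) ≡⟨ r (∑ V (g zero)) H _ ⟩
  H * (∑ V (g zero) * ∏ (λ j → ∑ V (g (suc j)))) ∎
  where
  open ≡-Reasoning
  V = vecs xs n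
  H = length xs ^ n
  rest : Vec α n → ℕ
  rest r = ∏ (λ j → g (suc j) r)
  rest-dep : DependsOn (not ∘ P zero) rest
  rest-dep = dependsOn-∏ λ j → dependsOn-weaken (λ u p → off j u p) (h (suc j))
    where
    off : ∀ j u → P (suc j) u ≡ true → not (P zero u) ≡ true
    off j u p with P zero u in P₀
    ... | false = refl
    ... | true  with disj zero (suc j) u P₀ p
    ... | ()
  r : ∀ a b c → a * (b * c) ≡ b * (a * c)
  r = solve-∀

-- The coordinates in T are exposed first; given them, the factors outside T
-- depend on one coordinate each.
∑-resample : ∀ (x₀ : α) (xs : List α) n (T : Fin n → Bool) (f : Fin n → α → Vec α n → ℕ) (c : Fin n → ℕ) →
  (∀ v x → DependsOn T (f v x)) →
  (∀ v → T v ≡ true → (∀ x r → f v x r ≤ 1) × length xs ≤ c v) →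
  (∀ v → T v ≡ false → ∀ r → ∑ xs (λ x → f v x r) ≤ c v) →
  ∑ (vecs xs n) (λ r → ∏ (λ v → f v (lookup r v) r)) ≤ ∏ c
∑-resample x₀ xs zero    T f c dep h₁ h₂ = ≤-refl
∑-resample {α = α} x₀ xs (suc n) T f c dep h₁ h₂ = by-head (T zero) refl
  where
  open ≤-Reasoning
  V = vecs xs n
  F : α → Vec α n → ℕ
  F x r = ∏ (λ v → f (suc v) (lookup r v) (x ∷ r))
  ih : ∀ x → ∑ V (F x) ≤ ∏ (c ∘ suc)
  ih x = ∑-resample x₀ xs n (T ∘ suc) (λ v y r → f (suc v) y (x ∷ r)) (c ∘ suc)
    (λ v y → dependsOn-tail T (dep (suc v) y) x)
    (λ v t → (λ y r → proj₁ (h₁ (suc v) t) y (x ∷ r)) , proj₂ (h₁ (suc v) t))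
    (λ v t r → h₂ (suc v) t (x ∷ r))
  by-head : ∀ b → T zero ≡ b → ∑ (vecs xs (suc n)) (λ r → ∏ (λ v → f v (lookup r v) r)) ≤ c zero * ∏ (c ∘ suc)
  by-head true t = begin
    ∑ (vecs xs (suc n)) (λ r → ∏ (λ v → f v (lookup r v) r))
      ≡⟨ ∑-vecs xs n _ ⟩
    ∑ xs (λ x → ∑ V (λ r → f zero x (x ∷ r) * F x r))
      ≤⟨ ∑-mono xs (λ x → ≤-trans (∑-mono V (λ r → ≤-trans (*-monoˡ-≤ (F x r) (proj₁ (h₁ zero t) x (x ∷ r)))
           (≤-reflexive (+-identityʳ (F x r))))) (ih x)) ⟩
    ∑ xs (λ _ → ∏ (c ∘ suc))
      ≡⟨ ∑-const xs _ ⟩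
    length xs * ∏ (c ∘ suc)
      ≤⟨ *-monoˡ-≤ (∏ (c ∘ suc)) (proj₂ (h₁ zero t)) ⟩
    c zero * ∏ (c ∘ suc) ∎
  by-head false t = begin
    ∑ (vecs xs (suc n)) (λ r → ∏ (λ v → f v (lookup r v) r))
      ≡⟨ ∑-vecs xs n _ ⟩
    ∑ xs (λ x → ∑ V (λ r → f zero x (x ∷ r) * F x r))
      -- No dependence set contains the head, so every vector argument may carry `x₀` there. The sum
      -- over `x` then reaches only the first argument of `f zero`.
      ≡⟨ ∑-cong xs (λ x → ∑-cong V (λ r → cong₂ _*_ (free zero x x r) (∏-cong (λ v → free (suc v) (lookup r v) x r)))) ⟩
    ∑ xs (λ x → ∑ V (λ r → f zero x (x₀ ∷ r) * F x₀ r))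
      ≡⟨ ∑-swap xs V _ ⟩
    ∑ V (λ r → ∑ xs (λ x → f zero x (x₀ ∷ r) * F x₀ r))
      ≡⟨ ∑-cong V (λ r → ∑-*ʳ xs _ (F x₀ r)) ⟩
    ∑ V (λ r → ∑ xs (λ x → f zero x (x₀ ∷ r)) * F x₀ r)
      ≤⟨ ∑-mono V (λ r → *-monoˡ-≤ (F x₀ r) (h₂ zero t (x₀ ∷ r))) ⟩
    ∑ V (λ r → c zero * F x₀ r)
      ≡⟨ ∑-*ˡ V (c zero) (F x₀) ⟩
    c zero * ∑ V (F x₀)
      ≤⟨ *-monoʳ-≤ (c zero) (ih x₀) ⟩
    c zero * ∏ (c ∘ suc) ∎
    where
    free : ∀ v y x r → f v y (x ∷ r) ≡ f v y (x₀ ∷ r)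
    free v y x r = dependsOn-head T (dep v y) t x x₀ r

-- Truncated colourings

-- Partial colourings are functions into Fin (suc k), with zero for "uncoloured".
coloured : ∀ {k} → Fin (suc k) → Bool
coloured zero    = false
coloured (suc _) = true

hasColour : ∀ {k} → Fin k → Fin (suc k) → Bool
hasColour j zero    = false
hasColour j (suc i) = ⌊ i ≟ᶠ j ⌋

supportSize : ∀ {n k} → Vec (Fin (suc k)) n → ℕ
supportSize σ = count (λ u → coloured (lookup σ u))

-- Such a colouring fits into `m` slots, each blank or holding one of the `n * k` pairs of vertex
-- and colour. The induction follows the first vertex: it is uncoloured, or it uses up one unit of
-- `m` in one of `k` ways.
smallSupports : ∀ k n m →
  ∑ (vecs (allFin (suc k)) n) (λ σ → ⟦ supportSize σ ≤ᵇ m ⟧) ≤ (1 + n * k) ^ m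
smallSupports k zero    m = ≤-reflexive (≡-sym (^-zeroˡ m))
smallSupports k (suc n) m = begin
  ∑ (vecs (allFin (suc k)) (suc n)) (λ σ → ⟦ supportSize σ ≤ᵇ m ⟧)
    ≡⟨ ∑-vecs (allFin (suc k)) n _ ⟩
  ∑ (allFin (suc k)) (λ x → ∑ V (λ σ → ⟦ supportSize (x ∷ σ) ≤ᵇ m ⟧))
    ≡⟨ ∑-cong (allFin (suc k)) (λ x → ∑-cong V (λ σ → cong (λ s → ⟦ s ≤ᵇ m ⟧) (count-suc (λ u → coloured (lookup (x ∷ σ) u))))) ⟩
  ∑ (allFin (suc k)) (λ x → ∑ V (λ σ → ⟦ ⟦ coloured x ⟧ + supportSize σ ≤ᵇ m ⟧))
    ≡⟨ ∑-allFin k _ ⟩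
  ∑ V (λ σ → ⟦ supportSize σ ≤ᵇ m ⟧) + ∑ (allFin k) (λ _ → ∑ V (λ σ → ⟦ suc (supportSize σ) ≤ᵇ m ⟧))
    ≡⟨ cong (∑ V (λ σ → ⟦ supportSize σ ≤ᵇ m ⟧) +_) (∑-allFin-const k _) ⟩
  ∑ V (λ σ → ⟦ supportSize σ ≤ᵇ m ⟧) + k * ∑ V (λ σ → ⟦ suc (supportSize σ) ≤ᵇ m ⟧)
    ≤⟨ bound m ⟩
  (1 + suc n * k) ^ m ∎
  where
  open ≤-Reasoning
  V = vecs (allFin (suc k)) n
  suc≤ᵇsuc : ∀ a b → (suc a ≤ᵇ suc b) ≡ (a ≤ᵇ b)
  suc≤ᵇsuc zero    b = refl
  suc≤ᵇsuc (suc a) b = refl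
  bound : ∀ m → ∑ V (λ σ → ⟦ supportSize σ ≤ᵇ m ⟧) + k * ∑ V (λ σ → ⟦ suc (supportSize σ) ≤ᵇ m ⟧) ≤ (1 + suc n * k) ^ m
  bound zero    = ≤-trans (≤-reflexive (trans (cong (λ x → ∑ V (λ σ → ⟦ supportSize σ ≤ᵇ 0 ⟧) + k * x) (∑-zero V))
    (trans (cong (∑ V (λ σ → ⟦ supportSize σ ≤ᵇ 0 ⟧) +_) (*-zeroʳ k)) (+-identityʳ _)))) (smallSupports k n 0)
  bound (suc m) = begin
    ∑ V (λ σ → ⟦ supportSize σ ≤ᵇ suc m ⟧) + k * ∑ V (λ σ → ⟦ suc (supportSize σ) ≤ᵇ suc m ⟧)
      ≡⟨ cong (λ x → ∑ V (λ σ → ⟦ supportSize σ ≤ᵇ suc m ⟧) + k * x) (∑-cong V (λ σ → cong ⟦_⟧ (suc≤ᵇsuc (supportSize σ) m))) ⟩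
    ∑ V (λ σ → ⟦ supportSize σ ≤ᵇ suc m ⟧) + k * ∑ V (λ σ → ⟦ supportSize σ ≤ᵇ m ⟧)
      ≤⟨ +-mono-≤ (smallSupports k n (suc m)) (*-monoʳ-≤ k (smallSupports k n m)) ⟩
    (1 + n * k) * (1 + n * k) ^ m + k * (1 + n * k) ^ m
      ≡⟨ r n k ((1 + n * k) ^ m) ⟩
    (1 + suc n * k) * (1 + n * k) ^ m
      ≤⟨ *-monoʳ-≤ (1 + suc n * k) (^-monoˡ-≤ m (s≤s (m≤n+m (n * k) k))) ⟩
    (1 + suc n * k) * (1 + suc n * k) ^ m ∎
    where
    r : ∀ n k x → (1 + n * k) * x + k * x ≡ (1 + (k + n * k)) * x
    r = solve-∀

record Truncation {n} (P : Fin n → Bool) (s : ℕ) : Set where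
  field
    part   : Fin n → Bool
    part⊆  : ∀ u → part u ≡ true → P u ≡ true
    size≤  : count part ≤ s
    full   : (∀ u → part u ≡ P u) ⊎ count part ≡ s

truncate : ∀ {n} (P : Fin n → Bool) s → Truncation P s
truncate {zero} P s = record { part = P ; part⊆ = λ () ; size≤ = z≤n ; full = inj₁ λ () }
truncate {suc n} P zero = record
  { part = λ _ → false ; part⊆ = λ _ () ; size≤ = ≤-reflexive empty ; full = inj₂ empty }
  where
  empty : count {suc n} (λ _ → false) ≡ 0
  empty = ∑-zero (allFin (suc n))
truncate {suc n} P (suc s) with P zero in P₀
... | true = record { part = part′ ; part⊆ = sub ; size≤ = subst (_≤ suc s) (≡-sym (count-suc part′)) (s≤s size≤) ; full = full′ full }
  where
  open Truncation (truncate (P ∘ suc) s)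
  part′ : Fin (suc n) → Bool
  part′ zero    = true
  part′ (suc u) = part u
  sub : ∀ u → part′ u ≡ true → P u ≡ true
  sub zero    _ = P₀
  sub (suc u) p = part⊆ u p
  full′ : (∀ u → part u ≡ P (suc u)) ⊎ count part ≡ s → (∀ u → part′ u ≡ P u) ⊎ count part′ ≡ suc s
  full′ (inj₁ e) = inj₁ λ { zero → ≡-sym P₀ ; (suc u) → e u }
  full′ (inj₂ e) = inj₂ (trans (count-suc part′) (cong suc e))
... | false = record { part = part′ ; part⊆ = sub ; size≤ = subst (_≤ suc s) (≡-sym (count-suc part′)) size≤ ; full = full′ full }
  where
  open Truncation (truncate (P ∘ suc) (suc s))
  part′ : Fin (suc n) → Bool
  part′ zero    = false
  part′ (suc u) = part u
  sub : ∀ u → part′ u ≡ true → P u ≡ true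
  sub (suc u) p = part⊆ u p
  full′ : (∀ u → part u ≡ P (suc u)) ⊎ count part ≡ suc s → (∀ u → part′ u ≡ P u) ⊎ count part′ ≡ suc s
  full′ (inj₁ e) = inj₁ λ { zero → ≡-sym P₀ ; (suc u) → e u }
  full′ (inj₂ e) = inj₂ (trans (count-suc part′) e)

⌊≟⌋≡true⇒≡ : ∀ {k} {i j : Fin k} → ⌊ i ≟ᶠ j ⌋ ≡ true → i ≡ j
⌊≟⌋≡true⇒≡ {i = i} {j} e with i ≟ᶠ j
... | yes p = p
⌊≟⌋≡true⇒≡ () | no _

⌊≟⌋-refl : ∀ {k} (i : Fin k) → ⌊ i ≟ᶠ i ⌋ ≡ true
⌊≟⌋-refl i with i ≟ᶠ i
... | yes _ = refl
... | no ¬p = contradiction refl ¬p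

-- The alternative in `class` is what makes truncation harmless: a class is either intact, so
-- sightings of it are exact, or it still has `s` members, enough to be seen twice.
record PartialColouring {n k} (c : Fin n → Fin k) (s : ℕ) : Set where
  field
    σ       : Vec (Fin (suc k)) n
    support : supportSize σ ≤ k * s
    class⊆  : ∀ j u → hasColour j (lookup σ u) ≡ true → ⌊ c u ≟ᶠ j ⌋ ≡ true
    class   : ∀ j → (∀ u → hasColour j (lookup σ u) ≡ ⌊ c u ≟ᶠ j ⌋) ⊎ count (λ u → hasColour j (lookup σ u)) ≡ s

truncateColouring : ∀ {n k} (c : Fin n → Fin k) s → PartialColouring c s
truncateColouring {n} {k} c s = record
  { σ = σ
  ; support = support
  ; class⊆ = λ j u h → T.part⊆ j u (trans (≡-sym (σ-class j u)) h)
  ; class = λ j → lift j (T.full j)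
  }
  where
  module T (j : Fin k) = Truncation (truncate (λ u → ⌊ c u ≟ᶠ j ⌋) s)
  f : Fin n → Fin (suc k)
  f u = if T.part (c u) u then suc (c u) else zero
  σ = tabulate f
  f-class : ∀ j u → hasColour j (f u) ≡ T.part j u
  f-class j u with c u ≟ᶠ j in q
  f-class j u | yes refl with T.part (c u) u
  ... | true  = cong ⌊_⌋ q
  ... | false = refl
  f-class j u | no c≢j with T.part j u in p
  ... | true  = contradiction (⌊≟⌋≡true⇒≡ (T.part⊆ j u p)) c≢j
  ... | false with T.part (c u) u
  ... | true  = cong ⌊_⌋ q
  ... | false = refl
  σ-class : ∀ j u → hasColour j (lookup σ u) ≡ T.part j u
  σ-class j u = trans (cong (hasColour j) (lookup∘tabulate f u)) (f-class j u)
  coloured≤ : ∀ u → ⟦ coloured (lookup σ u) ⟧ ≤ ∑ (allFin k) (λ j → ⟦ T.part j u ⟧)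
  coloured≤ u = ≤-trans (≤-reflexive (cong ⟦_⟧ (trans (cong coloured (lookup∘tabulate f u)) same)))
    (term≤∑ (λ j → ⟦ T.part j u ⟧) (c u))
    where
    same : coloured (f u) ≡ T.part (c u) u
    same with T.part (c u) u
    ... | true  = refl
    ... | false = refl
  support : supportSize σ ≤ k * s
  support = begin
    supportSize σ                                              ≤⟨ ∑-mono (allFin n) coloured≤ ⟩
    ∑ (allFin n) (λ u → ∑ (allFin k) (λ j → ⟦ T.part j u ⟧))   ≡⟨ ∑-swap (allFin n) (allFin k) _ ⟩
    ∑ (allFin k) (λ j → count (T.part j))                      ≤⟨ ∑-mono (allFin k) T.size≤ ⟩
    ∑ (allFin k) (λ _ → s)                                     ≡⟨ ∑-allFin-const k s ⟩
    k * s                                                      ∎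
    where open ≤-Reasoning
  lift : ∀ j → (∀ u → T.part j u ≡ ⌊ c u ≟ᶠ j ⌋) ⊎ count (T.part j) ≡ s → _
  lift j (inj₁ e) = inj₁ λ u → trans (σ-class j u) (e u)
  lift j (inj₂ e) = inj₂ (trans (count-cong (σ-class j)) e)

-- Failure of repeated trials.

bernoulli : ∀ B G y → B ^ suc y + suc y * G * B ^ y ≤ (B + G) ^ suc y
bernoulli B G zero    = ≤-reflexive (r B G)
  where
  r : ∀ B G → B * 1 + (G + 0) * 1 ≡ (B + G) * 1
  r = solve-∀
bernoulli B G (suc y) = begin
  B * (B * b) + (2 + y) * G * (B * b)                 ≤⟨ m≤m+n _ _ ⟩
  B * (B * b) + (2 + y) * G * (B * b) + G * (suc y * G * b)  ≡⟨ r B G y b ⟩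
  (B + G) * (B * b + suc y * G * b)                   ≤⟨ *-monoʳ-≤ (B + G) (bernoulli B G y) ⟩
  (B + G) * (B + G) ^ suc y                           ∎
  where
  open ≤-Reasoning
  b = B ^ y
  r : ∀ B G y b → B * (B * b) + (2 + y) * G * (B * b) + G * ((1 + y) * G * b) ≡ (B + G) * (B * b + (1 + y) * G * b)
  r = solve-∀

-- The first two binomial terms give `(B + G) ^ Y` at least `B ^ Y` plus `Y * G * B ^ (Y ∸ 1)`, and
-- the hypothesis makes the second at least `B ^ Y`. So `Y` trials failing with probability B / (B +
-- G) all fail with probability at most 1/2.
halving : ∀ B G Y → .{{NonZero Y}} → B ≤ Y * G → 2 * B ^ Y ≤ (B + G) ^ Y
halving B G (suc y) h = begin
  2 * (B * B ^ y)               ≡⟨ cong (B * B ^ y +_) (+-identityʳ _) ⟩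
  B * B ^ y + B * B ^ y         ≤⟨ +-monoʳ-≤ (B * B ^ y) (*-monoˡ-≤ (B ^ y) h) ⟩
  B * B ^ y + suc y * G * B ^ y ≤⟨ bernoulli B G y ⟩
  (B + G) ^ suc y               ∎
  where open ≤-Reasoning

-- The active factors contain `z` blocks of length `Y`, each of which gains a factor `β`; leftover
-- active factors are bounded by `H`.
∏-if-contract : ∀ {n} (act : Fin n → Bool) β B H Y z → B ≤ H → β * B ^ Y ≤ H ^ Y → z * Y ≤ count act →
  β ^ z * ∏ (λ v → if act v then B else H) ≤ H ^ n
∏-if-contract {n} act β B H Y z B≤H half h with m≤n⇒∃[o]m+o≡n h
... | e , eq = begin
  β ^ z * ∏ (λ v → if act v then B else H)     ≡⟨ cong (β ^ z *_) (∏-if act B H) ⟩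
  β ^ z * (B ^ count act * H ^ rest)           ≡⟨ cong (λ a → β ^ z * (B ^ a * H ^ rest)) (≡-sym eq) ⟩
  β ^ z * (B ^ (z * Y + e) * H ^ rest)         ≡⟨ cong (λ x → β ^ z * (x * H ^ rest)) (^-distribˡ-+-* B (z * Y) e) ⟩
  β ^ z * (B ^ (z * Y) * B ^ e * H ^ rest)     ≡⟨ r (β ^ z) (B ^ (z * Y)) (B ^ e) (H ^ rest) ⟩
  β ^ z * B ^ (z * Y) * (B ^ e * H ^ rest)     ≤⟨ *-mono-≤ (powers z) (*-monoˡ-≤ (H ^ rest) (^-monoˡ-≤ e B≤H)) ⟩
  H ^ (z * Y) * (H ^ e * H ^ rest)             ≡⟨ ≡-sym (*-assoc (H ^ (z * Y)) (H ^ e) _) ⟩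
  H ^ (z * Y) * H ^ e * H ^ rest               ≡⟨ cong (_* H ^ rest) (≡-sym (^-distribˡ-+-* H (z * Y) e)) ⟩
  H ^ (z * Y + e) * H ^ rest                   ≡⟨ cong (λ a → H ^ a * H ^ rest) eq ⟩
  H ^ count act * H ^ rest                     ≡⟨ ≡-sym (^-distribˡ-+-* H (count act) rest) ⟩
  H ^ (count act + rest)                       ≡⟨ cong (H ^_) (count-not act) ⟩
  H ^ n                                        ∎
  where
  open ≤-Reasoning
  rest = count (not ∘ act)
  r : ∀ a b c d → a * (b * c * d) ≡ a * b * (c * d)
  r = solve-∀
  powers : ∀ z → β ^ z * B ^ (z * Y) ≤ H ^ (z * Y)
  powers zero    = ≤-refl
  powers (suc z) = begin
    β * β ^ z * B ^ (Y + z * Y)           ≡⟨ cong (β * β ^ z *_) (^-distribˡ-+-* B Y (z * Y)) ⟩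
    β * β ^ z * (B ^ Y * B ^ (z * Y))     ≡⟨ *-interchange β (β ^ z) (B ^ Y) _ ⟩
    β * B ^ Y * (β ^ z * B ^ (z * Y))     ≤⟨ *-mono-≤ half (powers z) ⟩
    H ^ Y * H ^ (z * Y)                   ≡⟨ ≡-sym (^-distribˡ-+-* H Y (z * Y)) ⟩
    H ^ (Y + z * Y)                       ∎

-- The random graph

-- A class seen c times is harmless if c ≠ 1, but a truncated class (big = true)
-- only if c ≥ 2, since its discarded vertices may be seen too.
avoids : Bool → ℕ → ℕ
avoids big zero          = ⟦ not big ⟧
avoids big (suc zero)    = 0
avoids big (suc (suc c)) = 1

avoids≤1 : ∀ big c → avoids big c ≤ 1
avoids≤1 true  zero          = z≤n
avoids≤1 false zero          = ≤-refl
avoids≤1 big   (suc zero)    = z≤n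
avoids≤1 big   (suc (suc c)) = ≤-refl

avoids-small : ∀ c → avoids false c + isOne c ≡ 1
avoids-small zero          = refl
avoids-small (suc zero)    = refl
avoids-small (suc (suc c)) = refl

avoids-big : ∀ c → avoids true c + isFew c ≡ 1
avoids-big zero          = refl
avoids-big (suc zero)    = refl
avoids-big (suc (suc c)) = refl

isOne≤isFew : ∀ c → isOne c ≤ isFew c
isOne≤isFew c = m≤n+m (isOne c) (isZero c)

-- Here `z` is the weight of the complementary event, for which the preceding tail bounds are upper
-- bounds.
mkAvoids : ∀ {Q H A γ} z → γ + z ≡ H → 2 * z ≤ H → z * Q ≤ H * A → z * (Q + A) ≤ 2 * (Q * H) → Avoids Q H A γ
mkAvoids {Q} {A = A} {γ} z refl h₁ h₂ h₃ = record
  { γ≤H   = m≤m+n γ z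
  ; half  = +-cancelʳ-≤ z (γ + z) (2 * γ) (≤-trans (≤-reflexive (r₁ γ z)) (≤-trans (+-monoʳ-≤ γ h₁) (≤-reflexive (r₂ γ z))))
  ; small = ≤-trans (≤-reflexive (*-distribʳ-+ Q γ z)) (+-monoʳ-≤ (γ * Q) h₂)
  ; large = ≤-trans (≤-reflexive (*-distribʳ-+ (Q + A) γ z)) (+-monoʳ-≤ (γ * (Q + A)) h₃)
  }
  where
  r₁ : ∀ γ z → γ + z + z ≡ γ + 2 * z
  r₁ = solve-∀
  r₂ : ∀ γ z → γ + (γ + z) ≡ 2 * γ + z
  r₂ = solve-∀

-- The indicator of `c < D`, written so that `low (suc D) ∘ suc` is `low D`, as the recursion of `Z`
-- requires.
low : ℕ → ℕ → ℕ
low zero    c       = 0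
low (suc D) zero    = 1
low (suc D) (suc c) = low D c

low≤1 : ∀ D c → low D c ≤ 1
low≤1 zero    c       = z≤n
low≤1 (suc D) zero    = ≤-refl
low≤1 (suc D) (suc c) = low≤1 D c

low≡0 : ∀ D c → low D c ≡ 0 → D ≤ c
low≡0 zero    c       e = z≤n
low≡0 (suc D) (suc c) e = s≤s (low≡0 D c e)

-- Markov's inequality for 2 ^ (- number of successes).
Z-low : ∀ Q {n} (b : Fin n → ℕ) D → (∀ u → b u ≤ Q) → Z Q b (low D) * 2 ^ n ≤ 2 ^ D * ∏ (λ u → 2 * Q ∸ b u)
Z-low Q {zero}  b zero    h = z≤n
Z-low Q {zero}  b (suc D) h = ≤-trans (m^n>0 2 (suc D)) (≤-reflexive (≡-sym (*-identityʳ _)))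
Z-low Q {suc n} b zero    h = ≤-trans (≤-reflexive (cong (_* 2 ^ suc n) (Z-zero Q b))) z≤n
Z-low Q {suc n} b (suc D) h = begin
  (b zero * Z Q b′ (low D) + (Q ∸ b zero) * Z Q b′ (low (suc D))) * (2 * 2 ^ n)
    ≡⟨ r₁ (b zero) (Z Q b′ (low D)) (Q ∸ b zero) (Z Q b′ (low (suc D))) (2 ^ n) ⟩
  2 * b zero * (Z Q b′ (low D) * 2 ^ n) + 2 * (Q ∸ b zero) * (Z Q b′ (low (suc D)) * 2 ^ n)
    ≤⟨ +-mono-≤ (*-monoʳ-≤ (2 * b zero) (Z-low Q b′ D (h ∘ suc))) (*-monoʳ-≤ (2 * (Q ∸ b zero)) (Z-low Q b′ (suc D) (h ∘ suc))) ⟩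
  2 * b zero * (2 ^ D * X) + 2 * (Q ∸ b zero) * (2 * 2 ^ D * X)
    ≡⟨ r₂ (b zero) (2 ^ D) X (Q ∸ b zero) ⟩
  2 * 2 ^ D * ((b zero + (Q ∸ b zero) + (Q ∸ b zero)) * X)
    ≡⟨ cong (λ y → 2 * 2 ^ D * (y * X)) step ⟩
  2 * 2 ^ D * ((2 * Q ∸ b zero) * X) ∎
  where
  open ≤-Reasoning
  b′ = b ∘ suc
  X = ∏ (λ u → 2 * Q ∸ b′ u)
  step : b zero + (Q ∸ b zero) + (Q ∸ b zero) ≡ 2 * Q ∸ b zero
  step = trans (cong (_+ (Q ∸ b zero)) (m+[n∸m]≡n (h zero)))
    (trans (≡-sym (+-∸-assoc Q (h zero))) (cong (λ q → Q + q ∸ b zero) (≡-sym (+-identityʳ Q))))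
  r₁ : ∀ b x c y p → (b * x + c * y) * (2 * p) ≡ 2 * b * (x * p) + 2 * c * (y * p)
  r₁ = solve-∀
  r₂ : ∀ b p X c → 2 * b * (p * X) + 2 * c * (2 * p * X) ≡ 2 * p * ((b + c + c) * X)
  r₂ = solve-∀

term≤∑-vecs : ∀ {m} n (f : Vec (Fin m) n → ℕ) σ → f σ ≤ ∑ (vecs (allFin m) n) f
term≤∑-vecs zero    f [] = m≤m+n _ 0
term≤∑-vecs {m} (suc n) f (x ∷ σ) = begin
  f (x ∷ σ)                                                        ≤⟨ term≤∑-vecs n (f ∘ (x ∷_)) σ ⟩
  ∑ (vecs (allFin m) n) (f ∘ (x ∷_))                               ≤⟨ term≤∑ (λ y → ∑ (vecs (allFin m) n) (f ∘ (y ∷_))) x ⟩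
  ∑ (allFin m) (λ y → ∑ (vecs (allFin m) n) (f ∘ (y ∷_)))          ≡⟨ ≡-sym (∑-vecs (allFin m) n f) ⟩
  ∑ (vecs (allFin m) (suc n)) f                                    ∎
  where open ≤-Reasoning

ceiling : ∀ H Y → .{{NonZero H}} → .{{NonZero Y}} → ∃ λ g → H ≤ Y * g × (∀ G → H ≤ Y * G → g ≤ G)
-- For `H = suc h`, the quotient H / Y rounded up is `suc (h / Y)`.
ceiling (suc h) Y = suc (h / Y) , ≤-trans h<⌈⌉ (≤-reflexive (*-comm (suc (h / Y)) Y)) ,
  λ G le → m<n*o⇒m/o<n {h} {G} {Y} (≤-trans le (≤-reflexive (*-comm Y G)))
  where
  h<⌈⌉ : h < suc (h / Y) * Y
  h<⌈⌉ = subst (_< suc (h / Y) * Y) (≡-sym (m≡m%n+[m/n]*n h Y)) (+-monoˡ-< (h / Y * Y) (m%n<n h Y))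

⌊≟⌋-sym : ∀ {n} (u v : Fin n) → ⌊ u ≟ᶠ v ⌋ ≡ ⌊ v ≟ᶠ u ⌋
⌊≟⌋-sym u v with u ≟ᶠ v | v ≟ᶠ u
... | yes _ | yes _ = refl
... | no _  | no _  = refl
... | yes p | no ¬q = contradiction (≡-sym p) ¬q
... | no ¬p | yes q = contradiction (≡-sym q) ¬p

^-distribʳ-* : ∀ n a b → (a * b) ^ n ≡ a ^ n * b ^ n
^-distribʳ-* n a b = trans (≡-sym (∏-const n (a * b))) (trans (∏-* {n} (λ _ → a) (λ _ → b)) (cong₂ _*_ (∏-const n a) (∏-const n b)))

-- The weights `w` restrict the union to admissible `y`. The factor 4 leaves room for a second
-- family of bad events in `quarters`.
union-bound : ∀ {A B : Set} (xs : List A) (ys : List B) (w : B → ℕ) (f : B → A → ℕ) X S {T} .{{_ : NonZero S}} →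
  (∀ y → X * (w y * ∑ xs (f y)) ≤ w y * T) → ∑ ys w ≤ S → 4 * S ≤ X →
  4 * ∑ xs (λ x → ∑ ys (λ y → w y * f y x)) ≤ T
union-bound xs ys w f X S {T} each total 4S≤X = *-cancelʳ-≤ _ _ S (begin
  4 * U * S                                        ≡⟨ r U S ⟩
  4 * S * U                                        ≤⟨ *-monoˡ-≤ U 4S≤X ⟩
  X * U                                            ≡⟨ cong (X *_) (∑-swap xs ys _) ⟩
  X * ∑ ys (λ y → ∑ xs (λ x → w y * f y x))        ≡⟨ cong (X *_) (∑-cong ys (λ y → ∑-*ˡ xs (w y) (f y))) ⟩
  X * ∑ ys (λ y → w y * ∑ xs (f y))                ≡⟨ ≡-sym (∑-*ˡ ys X _) ⟩
  ∑ ys (λ y → X * (w y * ∑ xs (f y)))              ≤⟨ ∑-mono ys each ⟩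
  ∑ ys (λ y → w y * T)                             ≡⟨ ∑-*ʳ ys w T ⟩
  ∑ ys w * T                                       ≤⟨ *-monoˡ-≤ T total ⟩
  S * T                                            ≡⟨ *-comm S T ⟩
  T * S                                            ∎)
  where
  open ≤-Reasoning
  U = ∑ xs (λ x → ∑ ys (λ y → w y * f y x))
  r : ∀ x c → 4 * x * c ≡ 4 * c * x
  r = solve-∀

quarters : ∀ {A : Set} (xs : List A) (f g : A → ℕ) T → 0 < T → length xs ≡ T →
  4 * ∑ xs f ≤ T → 4 * ∑ xs g ≤ T → ∑ xs (λ x → f x + g x) < length xs
quarters xs f g T T>0 refl hf hg = *-cancelˡ-< 4 _ _ (begin-strict
  4 * ∑ xs (λ x → f x + g x)      ≡⟨ cong (4 *_) (∑-+ xs f g) ⟩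
  4 * (∑ xs f + ∑ xs g)           ≡⟨ *-distribˡ-+ 4 (∑ xs f) (∑ xs g) ⟩
  4 * ∑ xs f + 4 * ∑ xs g         ≤⟨ +-mono-≤ hf hg ⟩
  T + T                           <⟨ +-monoʳ-< T (m<m+n T (≤-trans T>0 (m≤m+n T _))) ⟩
  4 * T                           ∎)
  where open ≤-Reasoning

T⇒≡true : ∀ {x} → T x → x ≡ true
T⇒≡true {true} _ = refl

≢⇒⌊≟⌋≡false : ∀ {n} {u v : Fin n} → ¬ u ≡ v → ⌊ u ≟ᶠ v ⌋ ≡ false
≢⇒⌊≟⌋≡false {u = u} {v} u≢v with u ≟ᶠ v
... | yes p = contradiction p u≢v
... | no _  = refl

-- Multiply the hypotheses over all `j` and exchange the products: if every `e` failed, the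
-- resulting product over `e` would be too small, since `c ^ k` distributes as one `Y` per `e`.
product-pigeonhole : ∀ {t k} H c Y (Γ : Fin k → Fin (suc t) → ℕ) → c ^ k ≡ Y ^ suc t →
  (∀ j → H ^ suc t ≤ c * ∏ (Γ j)) → ∃ λ e → H ^ k ≤ Y * ∏ (λ j → Γ j e)
product-pigeonhole {t′} {k} H c Y Γ eq h with any? (λ e → H ^ k ≤? Y * ∏ (λ j → Γ j e))
... | yes p = p
... | no ¬p = contradiction (begin-strict
  (H ^ k) ^ t                             ≡⟨ ^-*-assoc H k t ⟩
  H ^ (k * t)                             ≡⟨ cong (H ^_) (*-comm k t) ⟩
  H ^ (t * k)                             ≡⟨ ≡-sym (^-*-assoc H t k) ⟩
  (H ^ t) ^ k                             ≡⟨ ≡-sym (∏-const k (H ^ t)) ⟩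
  ∏ {k} (λ _ → H ^ t)                     ≤⟨ ∏-mono h ⟩
  ∏ (λ j → c * ∏ (Γ j))                   ≡⟨ ∏-* (λ _ → c) (λ j → ∏ (Γ j)) ⟩
  ∏ {k} (λ _ → c) * ∏ (λ j → ∏ (Γ j))     ≡⟨ cong₂ _*_ (trans (∏-const k c) eq) (∏-swap Γ) ⟩
  Y ^ t * ∏ X                             ≡⟨ cong (_* ∏ X) (≡-sym (∏-const t Y)) ⟩
  ∏ {t} (λ _ → Y) * ∏ X                   ≡⟨ ≡-sym (∏-* (λ _ → Y) X) ⟩
  ∏ (λ e → Y * X e)                       <⟨ ∏-mono-< (λ e → ≰⇒> (λ le → ¬p (e , le))) ⟩
  ∏ {t} (λ _ → H ^ k)                     ≡⟨ ∏-const t (H ^ k) ⟩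
  (H ^ k) ^ t                             ∎) (<-irrefl refl)
  where
  open ≤-Reasoning
  t = suc t′
  X : Fin t → ℕ
  X e = ∏ (λ j → Γ j e)

1≤∏ : ∀ {n} (f : Fin n → ℕ) → 1 ≤ ∏ f → ∀ i → 1 ≤ f i
1≤∏ {suc n} f h zero    = n≢0⇒n>0 λ e → <⇒≢ h (≡-sym (cong (_* ∏ (f ∘ suc)) e))
1≤∏ {suc n} f h (suc i) = 1≤∏ (f ∘ suc)
  (n≢0⇒n>0 λ e → <⇒≢ h (≡-sym (trans (cong (f zero *_) e) (*-zeroʳ (f zero))))) i

⌊≟⌋-suc : ∀ {n} (u w : Fin n) → ⌊ suc u ≟ᶠ suc w ⌋ ≡ ⌊ u ≟ᶠ w ⌋
⌊≟⌋-suc u w with u ≟ᶠ w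
... | yes _ = refl
... | no _  = refl

count-single : ∀ {n} (w : Fin n) → count (λ u → ⌊ u ≟ᶠ w ⌋) ≡ 1
count-single {suc n} zero    = trans (count-suc {n} (λ u → ⌊ u ≟ᶠ zero ⌋)) (cong suc (∑-zero (allFin n)))
count-single {suc n} (suc w) = trans (count-suc (λ u → ⌊ u ≟ᶠ suc w ⌋)) (trans (count-cong (λ u → ⌊≟⌋-suc u w)) (count-single w))

-- An entry of a row is a label from `Θs`. As `agree e` holds for `2 ^ e` of the `2 ^ suc (2 * s)`
-- labels and `e ≤ 2 * s`, edges have probability at most 1/2.
module RandomGraph
  {Θ : Set} (Θs : List Θ) (θ₀ : Θ)
  (agree : ℕ → Θ → Θ → Bool) (agree-sym : ∀ e x y → agree e x y ≡ agree e y x)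
  (s : ℕ) (agree-count : ∀ e → e ≤ 2 * s → ∀ y → ∑ Θs (λ x → ⟦ agree e x y ⟧) ≡ 2 ^ e)
  (|Θ| : length Θs ≡ 2 ^ suc (2 * s))
  (k Y : ℕ) {{_ : NonZero Y}} (128^k : 128 ^ k ≡ Y ^ suc s)
  {n : ℕ} (level : Fin n → Fin (suc s))
  where

  t Q H : ℕ
  t = suc s
  Q = length Θs
  H = Q ^ n

  d : Fin n → ℕ
  d v = toℕ (level v)

  Row : Set
  Row = Vec Θ n

  Rows : List Row
  Rows = vecs Θs n

  |Rows| : length Rows ≡ H
  |Rows| = length-vecs Θs n

  row₀ : Row
  row₀ = tabulate (λ _ → θ₀)

  instance
    Q≢0 : NonZero Q
    Q≢0 = subst NonZero (≡-sym |Θ|) (m^n≢0 2 (suc (2 * s)))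
    H≢0 : NonZero H
    H≢0 = m^n≢0 Q n

  d≤s : ∀ v → d v ≤ s
  d≤s v = s≤s⁻¹ (toℕ<n (level v))

  d+d≤2s : ∀ {e} v → e ≤ s → e + d v ≤ 2 * s
  d+d≤2s v h = ≤-trans (+-mono-≤ h (d≤s v)) (≤-reflexive (cong (s +_) (≡-sym (+-identityʳ s))))

  weight≤ : ∀ {e} v → e ≤ s → 2 * 2 ^ (e + d v) ≤ Q
  weight≤ {e} v h = subst (2 * 2 ^ (e + d v) ≤_) (≡-sym |Θ|) (*-monoʳ-≤ 2 (^-monoʳ-≤ 2 (d+d≤2s v h)))

  -- The label `θ` that `v` holds for `u` is kept apart from `ω`, of which only the row of `u`
  -- matters. The row of `v` can thus be resampled while the others stay fixed.
  edge : Fin n → Vec Row n → Fin n → Θ → Bool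
  edge v ω u θ = not ⌊ v ≟ᶠ u ⌋ ∧ agree (d v + d u) θ (lookup (lookup ω u) v)

  adjacent : Vec Row n → Fin n → Fin n → Bool
  adjacent ω v u = edge v ω u (lookup (lookup ω v) u)

  graph : Vec Row n → Graph n
  graph ω = record
    { adj = adjacent ω
    ; sym = λ u v → cong₂ _∧_ (cong not (⌊≟⌋-sym u v))
        (trans (agree-sym (d u + d v) _ _) (cong (λ e → agree e (lookup (lookup ω v) u) (lookup (lookup ω u) v)) (+-comm (d u) (d v))))
    ; irrefl = λ v → cong (λ b → not b ∧ agree (d v + d v) (lookup (lookup ω v) v) (lookup (lookup ω v) v)) (⌊≟⌋-refl v)
    }

  edge-count : ∀ v ω u → ∑ Θs (λ θ → ⟦ edge v ω u θ ⟧) ≡ (if ⌊ v ≟ᶠ u ⌋ then 0 else 2 ^ (d v + d u))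
  edge-count v ω u with v ≟ᶠ u
  ... | yes _ = ∑-zero Θs
  ... | no _  = agree-count (d v + d u) (d+d≤2s u (d≤s v)) _

  -- One truncated colouring against the random graph.

  module Against (σ : Vec (Fin (suc k)) n) where

    class : Fin k → Fin n → Bool
    class j u = hasColour j (lookup σ u)

    isBig : Fin k → Bool
    isBig j = 3 * Q ≤ᵇ count (class j)

    b : ℕ → Fin k → Fin n → ℕ
    b e j u = if class j u then 2 ^ (e + d u) else 0

    W : Fin k → ℕ
    W j = ∑ (allFin n) (λ u → if class j u then 2 ^ d u else 0)

    ∑b : ∀ e j → ∑ (allFin n) (b e j) ≡ 2 ^ e * W j
    ∑b e j = trans (∑-cong (allFin n) (λ u → lem (class j u) u)) (∑-*ˡ (allFin n) (2 ^ e) _)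
      where
      lem : ∀ c u → (if c then 2 ^ (e + d u) else 0) ≡ 2 ^ e * (if c then 2 ^ d u else 0)
      lem true  u = ^-distribˡ-+-* 2 e (d u)
      lem false u = ≡-sym (*-zeroʳ (2 ^ e))

    -- Divided by `H`, this is the probability that an uncoloured vertex of level `e` avoids class
    -- `j`.
    Γ : Fin k → ℕ → ℕ
    Γ j e = Z Q (b e j) (avoids (isBig j))

    2*b≤Q : ∀ {e} → e ≤ s → ∀ j u → 2 * b e j u ≤ Q
    2*b≤Q h j u with class j u
    ... | true  = weight≤ u h
    ... | false = z≤n

    -- For a small class the bad event is being seen exactly once, bounded in all three ways. For a
    -- big class it is being seen at most once; since x ≥ 3, the bound 2 / (1 + x) already gives
    -- 1/2, and the bound x is trivial.
    Γ-avoids : ∀ j {e} → e < t → Avoids Q H (2 ^ e * W j) (Γ j e)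
    Γ-avoids j {e} (s≤s e≤s) = by-size (isBig j) refl
      where
      open ≤-Reasoning
      2b≤Q = 2*b≤Q e≤s j
      b≤Q : ∀ u → b e j u ≤ Q
      b≤Q u = 2*m≤n⇒m≤n (2b≤Q u)
      A = 2 ^ e * W j
      few-tail : Z Q (b e j) isFew * (Q + A) ≤ 2 * (Q * H)
      few-tail = subst (λ a → Z Q (b e j) isFew * (Q + a) ≤ 2 * (Q * H)) (∑b e j) (Z-few-tail Q (b e j) 2b≤Q)
      by-size : ∀ big → isBig j ≡ big → Avoids Q H A (Z Q (b e j) (avoids big))
      by-size false _ = mkAvoids (Z Q (b e j) isOne)
        (Z-complement Q (b e j) _ _ b≤Q avoids-small)
        (2*Z-one Q (b e j) 2b≤Q)
        (subst (λ a → Z Q (b e j) isOne * Q ≤ H * a) (∑b e j) (Z-one-upper Q (b e j) 2b≤Q))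
        (≤-trans (*-monoˡ-≤ (Q + A) (Z-mono Q (b e j) isOne≤isFew)) few-tail)
      by-size true isbig = mkAvoids F
        (Z-complement Q (b e j) _ _ b≤Q avoids-big)
        (*-cancelˡ-≤ (2 * Q) {{m*n≢0 2 Q}} (begin
          2 * Q * (2 * F)         ≡⟨ r Q F ⟩
          F * (Q + 3 * Q)         ≤⟨ *-monoʳ-≤ F (+-monoʳ-≤ Q 3Q≤A) ⟩
          F * (Q + A)             ≤⟨ few-tail ⟩
          2 * (Q * H)             ≡⟨ ≡-sym (*-assoc 2 Q H) ⟩
          2 * Q * H               ∎))
        (*-mono-≤ (Z≤ Q (b e j) isFew b≤Q isFew≤1) (≤-trans (m≤m+n Q _) 3Q≤A))
        few-tail
        where
        F = Z Q (b e j) isFew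
        r : ∀ Q F → 2 * Q * (2 * F) ≡ F * (Q + 3 * Q)
        r = solve-∀
        class≤ : ∀ c u → ⟦ c ⟧ ≤ (if c then 2 ^ d u else 0)
        class≤ true  u = m^n>0 2 (d u)
        class≤ false u = z≤n
        3Q≤A : 3 * Q ≤ A
        3Q≤A = begin
          3 * Q             ≤⟨ ≤ᵇ⇒≤ (3 * Q) _ (subst T (≡-sym isbig) _) ⟩
          count (class j)   ≤⟨ ∑-mono (allFin n) (λ u → class≤ (class j u) u) ⟩
          W j               ≤⟨ m≤m*n (W j) (2 ^ e) {{m^n≢0 2 e}} ⟩
          W j * 2 ^ e       ≡⟨ *-comm (W j) _ ⟩
          A                 ∎

    -- For fixed `j` the means `2 ^ e * W j` double with `e`, so `all-scales` bounds the product
    -- over levels. Averaging over levels gives one where all classes are avoided with probability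
    -- at least 1 / Y.
    good-level : ∃ λ (e : Fin t) → H ^ k ≤ Y * ∏ (λ j → Γ j (toℕ e))
    good-level = product-pigeonhole {s} H 128 Y (λ j e → Γ j (toℕ e)) 128^k
      (λ j → all-scales Q H t (Γ-avoids j) (λ e → *-assoc 2 (2 ^ e) (W j)))

    good-level-index : Fin t
    good-level-index = proj₁ good-level

    -- `g` is H / Y rounded up, a lower bound for the number of good rows of an active vertex; so
    -- `B` bounds the failing rows uniformly in the vertex and in `ω`.
    g B : ℕ
    g = proj₁ (ceiling H Y)
    B = H ∸ g

    H≤Y*g : H ≤ Y * g
    H≤Y*g = proj₁ (proj₂ (ceiling H Y))

    g-least : ∀ G → H ≤ Y * G → g ≤ G
    g-least = proj₂ (proj₂ (ceiling H Y))

    g≤H : g ≤ H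
    g≤H = g-least H (m≤n*m H Y)

    2*B^Y≤H^Y : 2 * B ^ Y ≤ H ^ Y
    2*B^Y≤H^Y = subst (λ h → 2 * B ^ Y ≤ h ^ Y) (m∸n+n≡m g≤H)
      (halving B g Y (≤-trans (m∸n≤m H g) H≤Y*g))

    seen : Fin n → Vec Row n → Fin k → Row → ℕ
    seen v ω j r = count (λ u → class j u ∧ edge v ω u (lookup r u))

    good : Fin n → Vec Row n → Row → ℕ
    good v ω r = ∏ (λ j → avoids (isBig j) (seen v ω j r))

    good≤1 : ∀ v ω r → good v ω r ≤ 1
    good≤1 v ω r = ∏≤1 (λ j → avoids (isBig j) (seen v ω j r)) (λ j → avoids≤1 (isBig j) (seen v ω j r))

    class⇒coloured : ∀ j u → class j u ≡ true → coloured (lookup σ u) ≡ true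
    class⇒coloured j u h with lookup σ u
    ... | suc _ = refl

    class-disjoint : ∀ i j u → class i u ≡ true → class j u ≡ true → i ≡ j
    class-disjoint i j u p q with lookup σ u
    ... | suc c = trans (≡-sym (⌊≟⌋≡true⇒≡ p)) (⌊≟⌋≡true⇒≡ q)

    -- Being uncoloured puts `v` outside every class: its own closed-neighbourhood entry never
    -- counts, and its row is not read by the failure events of other vertices.
    active : Fin n → Bool
    active v = ⌊ level v ≟ᶠ good-level-index ⌋ ∧ not (coloured (lookup σ v))

    active⇒ : ∀ v → active v ≡ true → level v ≡ good-level-index × coloured (lookup σ v) ≡ false
    active⇒ v h with level v ≟ᶠ good-level-index | coloured (lookup σ v)
    ... | yes p | false = p , refl

    seen-weights : ∀ v ω → active v ≡ true → ∀ j u →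
      ∑ Θs (λ θ → ⟦ class j u ∧ edge v ω u θ ⟧) ≡ b (toℕ good-level-index) j u
    seen-weights v ω act j u with class j u in c
    ... | false = ∑-zero Θs
    ... | true  = trans (edge-count v ω u) lem
      where
      lem : (if ⌊ v ≟ᶠ u ⌋ then 0 else 2 ^ (d v + d u)) ≡ 2 ^ (toℕ good-level-index + d u)
      lem with v ≟ᶠ u
      ... | no _ = cong (λ l → 2 ^ (toℕ l + d u)) (proj₁ (active⇒ v act))
      -- A loop cannot arise: `u` is coloured, whereas an active `v` is not.
      ... | yes refl with trans (≡-sym (proj₂ (active⇒ v act))) (class⇒coloured j u c)
      ... | ()

    -- The classes occupy disjoint coordinates of the row of `v`, so the probabilities of avoiding
    -- them multiply, and `good-level` bounds the product.
    many-good-rows : ∀ v ω → active v ≡ true → H ≤ Y * ∑ Rows (good v ω)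
    many-good-rows v ω act = *-cancelʳ-≤ H (Y * G) (H ^ k) {{m^n≢0 H k}} (begin
      H * H ^ k                        ≤⟨ *-monoʳ-≤ H (proj₂ good-level) ⟩
      H * (Y * ∏ (λ j → Γ j (toℕ good-level-index)))  ≡⟨ r H Y _ ⟩
      Y * (H * ∏ (λ j → Γ j (toℕ good-level-index)))  ≡⟨ cong (Y *_) (≡-sym indep) ⟩
      Y * (G * H ^ k)                  ≡⟨ ≡-sym (*-assoc Y G (H ^ k)) ⟩
      Y * G * H ^ k                    ∎)
      where
      open ≤-Reasoning
      G = ∑ Rows (good v ω)
      r : ∀ x y z → x * (y * z) ≡ y * (x * z)
      r = solve-∀
      dep : ∀ j → DependsOn (class j) (λ r → avoids (isBig j) (seen v ω j r))
      dep j r r′ h = cong (avoids (isBig j)) (count-cong λ u → same u (class j u) refl)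
        where
        same : ∀ u c → class j u ≡ c → (c ∧ edge v ω u (lookup r u)) ≡ (c ∧ edge v ω u (lookup r′ u))
        same u true  e = cong (edge v ω u) (h u e)
        same u false e = refl
      indep : G * H ^ k ≡ H * ∏ (λ j → Γ j (toℕ good-level-index))
      indep = trans
        (∑-∏-independent Θs n k class (λ j r → avoids (isBig j) (seen v ω j r)) class-disjoint dep)
        (cong (H *_) (∏-cong (λ j → trans
          (∑-vecs-count Θs n (λ u θ → class j u ∧ edge v ω u θ) (avoids (isBig j)))
          (Z-cong Q (avoids (isBig j)) (seen-weights v ω act j)))))

    few-bad-rows : ∀ v ω → active v ≡ true → ∑ Rows (λ r → 1 ∸ good v ω r) ≤ B
    few-bad-rows v ω act = begin
      bad                ≡⟨ ≡-sym (m+n∸n≡m bad G) ⟩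
      bad + G ∸ G        ≡⟨ cong (_∸ G) total ⟩
      H ∸ G              ≤⟨ ∸-monoʳ-≤ H (g-least G (many-good-rows v ω act)) ⟩
      H ∸ g              ∎
      where
      open ≤-Reasoning
      G = ∑ Rows (good v ω)
      bad = ∑ Rows (λ r → 1 ∸ good v ω r)
      total : bad + G ≡ H
      total = trans (≡-sym (∑-+ Rows _ _)) (trans (∑-cong Rows (λ r → m∸n+n≡m (good≤1 v ω r)))
        (trans (≡-sym (length≡∑1 Rows)) |Rows|))

    fails : Fin n → Row → Vec Row n → ℕ
    fails v x ω = if active v then 1 ∸ good v ω x else 1

    undefeated : Vec Row n → ℕ
    undefeated ω = ∏ (λ v → fails v (lookup ω v) ω)

    -- Once the rows of coloured vertices are exposed, active vertices fail independently, each in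
    -- at most `B` rows. At least `N` vertices lie on the good level and at most `m` are coloured,
    -- so `z * Y` active ones remain, and each `Y` of them contribute a factor 1/2.
    few-undefeated : ∀ m N z → supportSize σ ≤ m → m + z * Y ≤ N →
      (∀ e → N ≤ count (λ v → ⌊ level v ≟ᶠ e ⌋)) →
      2 ^ z * ∑ (vecs Rows n) undefeated ≤ H ^ n
    few-undefeated m N z supp≤m m+zY≤N N≤ = ≤-trans
      (*-monoʳ-≤ (2 ^ z) (∑-resample row₀ Rows n (λ u → coloured (lookup σ u)) fails
        (λ v → if active v then B else H) dep on off))
      (∏-if-contract active 2 B H Y z (m∸n≤m H g) 2*B^Y≤H^Y enough)
      where
      open ≤-Reasoning
      dep : ∀ v x → DependsOn (λ u → coloured (lookup σ u)) (fails v x)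
      dep v x ω ω′ h = cong (λ y → if active v then 1 ∸ y else 1)
        (∏-cong λ j → cong (avoids (isBig j)) (count-cong λ u → same j u (class j u) refl))
        where
        same : ∀ j u c → class j u ≡ c → (c ∧ edge v ω u (lookup x u)) ≡ (c ∧ edge v ω′ u (lookup x u))
        same j u false e = refl
        same j u true  e = cong (λ row → not ⌊ v ≟ᶠ u ⌋ ∧ agree (d v + d u) (lookup x u) (lookup row v))
          (h u (class⇒coloured j u e))
      inactive : ∀ v → coloured (lookup σ v) ≡ true → active v ≡ false
      inactive v c rewrite c with ⌊ level v ≟ᶠ good-level-index ⌋
      ... | true  = refl
      ... | false = refl
      on : ∀ v → coloured (lookup σ v) ≡ true →
        (∀ x ω → fails v x ω ≤ 1) × length Rows ≤ (if active v then B else H)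
      on v c rewrite inactive v c = (λ _ _ → ≤-refl) , ≤-reflexive |Rows|
      off : ∀ v → coloured (lookup σ v) ≡ false → ∀ ω →
        ∑ Rows (λ x → fails v x ω) ≤ (if active v then B else H)
      off v _ ω with active v in act
      ... | true  = few-bad-rows v ω act
      ... | false = ≤-reflexive (trans (≡-sym (length≡∑1 Rows)) |Rows|)
      split : ∀ l c → ⟦ l ⟧ ≤ ⟦ l ∧ not c ⟧ + ⟦ c ⟧
      split false c     = z≤n
      split true  true  = ≤-refl
      split true  false = ≤-refl
      enough : z * Y ≤ count active
      enough = +-cancelˡ-≤ m _ _ (begin
        m + z * Y                                       ≤⟨ m+zY≤N ⟩
        N                                               ≤⟨ N≤ good-level-index ⟩
        count (λ v → ⌊ level v ≟ᶠ good-level-index ⌋)   ≤⟨ ∑-mono (allFin n) (λ v → split _ (coloured (lookup σ v))) ⟩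
        ∑ (allFin n) (λ v → ⟦ active v ⟧ + ⟦ coloured (lookup σ v) ⟧)  ≡⟨ ∑-+ (allFin n) _ _ ⟩
        count active + supportSize σ                    ≤⟨ +-monoʳ-≤ (count active) supp≤m ⟩
        count active + m                                ≡⟨ +-comm (count active) m ⟩
        m + count active                                ∎)

    survivor : ∀ ω → undefeated ω ≡ 0 → ∃ λ v → active v ≡ true × 1 ≤ good v ω (lookup ω v)
    survivor ω e = proj₁ found , not-failed (active (proj₁ found)) refl (proj₂ found)
      where
      found : ∃ λ v → fails v (lookup ω v) ω ≡ 0
      found = ∏≡0⇒∃0 (λ v → fails v (lookup ω v) ω) e
      v = proj₁ found
      not-failed : ∀ a → active v ≡ a → (if a then 1 ∸ good v ω (lookup ω v) else 1) ≡ 0 →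
        active v ≡ true × 1 ≤ good v ω (lookup ω v)
      not-failed true e h = e , m∸n≡0⇒m≤n h

    closed≡seen : ∀ ω (c : Fin n → Fin k) v j → coloured (lookup σ v) ≡ false →
      (∀ u → class j u ≡ ⌊ c u ≟ᶠ j ⌋) →
      count (λ u → inClosedNbhd (graph ω) v u ∧ ⌊ c u ≟ᶠ j ⌋) ≡ seen v ω j (lookup ω v)
    closed≡seen ω c v j blank e = count-cong λ u →
      trans (cong (inClosedNbhd (graph ω) v u ∧_) (≡-sym (e u))) (at u (class j u) refl)
      where
      at : ∀ u x → class j u ≡ x → inClosedNbhd (graph ω) v u ∧ x ≡ x ∧ adjacent ω v u
      at u false h = ∧-zeroʳ (inClosedNbhd (graph ω) v u)
      at u true  h = trans (∧-identityʳ _) (cong (_∨ adjacent ω v u) (≢⇒⌊≟⌋≡false u≢v))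
        where
        u≢v : ¬ u ≡ v
        u≢v refl with trans (≡-sym blank) (class⇒coloured j v h)
        ... | ()

    seen≤closed : ∀ ω (c : Fin n → Fin k) v j → (∀ u → class j u ≡ true → ⌊ c u ≟ᶠ j ⌋ ≡ true) →
      seen v ω j (lookup ω v) ≤ count (λ u → inClosedNbhd (graph ω) v u ∧ ⌊ c u ≟ᶠ j ⌋)
    seen≤closed ω c v j h = count-mono λ u → at ⌊ u ≟ᶠ v ⌋ (class j u) (adjacent ω v u) (h u)
      where
      at : ∀ p x y {z} → (x ≡ true → z ≡ true) → x ∧ y ≡ true → (p ∨ y) ∧ z ≡ true
      at true  true true h _ = h refl
      at false true true h _ = h refl

    -- For an intact class the closed neighbourhood contains exactly the members seen, whose number
    -- is not one. A cut class has `3 * Q` members, hence counts as big and is seen at least twice;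
    -- discarded members only add to this.
    unseen-colour : ∀ ω (c : Fin n → Fin k) v j → active v ≡ true → 1 ≤ avoids (isBig j) (seen v ω j (lookup ω v)) →
      (∀ u → class j u ≡ true → ⌊ c u ≟ᶠ j ⌋ ≡ true) →
      (∀ u → class j u ≡ ⌊ c u ≟ᶠ j ⌋) ⊎ count (class j) ≡ 3 * Q →
      ¬ count (λ u → inClosedNbhd (graph ω) v u ∧ ⌊ c u ≟ᶠ j ⌋) ≡ 1
    unseen-colour ω c v j act avoided sub (inj₁ e) one =
      not-one (isBig j) _ avoided (trans (≡-sym (closed≡seen ω c v j (proj₂ (active⇒ v act)) e)) one)
      where
      not-one : ∀ big x → 1 ≤ avoids big x → ¬ x ≡ 1
      not-one big (suc (suc x)) h ()
      not-one big (suc zero) () refl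
    unseen-colour ω c v j act avoided sub (inj₂ full) one =
      many _ (subst (λ big → 1 ≤ avoids big (seen v ω j (lookup ω v))) (T⇒≡true (≤⇒≤ᵇ (≤-reflexive (≡-sym full)))) avoided)
        (≤-trans (seen≤closed ω c v j sub) (≤-reflexive one))
      where
      many : ∀ x → 1 ≤ avoids true x → ¬ x ≤ 1
      many (suc (suc x)) _ (s≤s ())

  -- Vertices of low degree.

  lowDegree : ℕ → Fin n → Fin n → Row → Vec Row n → ℕ
  lowDegree D w v x ω = if ⌊ v ≟ᶠ w ⌋ then low D (count (λ u → edge v ω u (lookup x u))) else 1

  -- All factors but the one at `w` equal 1; the product form is there for `∑-resample`.
  hasLowDegree : ℕ → Fin n → Vec Row n → ℕ
  hasLowDegree D w ω = ∏ (λ v → lowDegree D w v (lookup ω v) ω)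

  -- The mean of 2 ^ (- degree) is at most (1 - 1 / (2Q)) ^ (n - 1), every vertex other than `w`
  -- being joined for at least one label. By `halving` this is at most 2 ^ (- (D + ℓ)), and Markov's
  -- inequality costs 2 ^ D. The `suc` in the hypothesis accounts for `w` itself.
  few-low-rows : ∀ D ℓ → suc ((D + ℓ) * (2 * Q)) ≤ n → ∀ w ω →
    2 ^ ℓ * ∑ Rows (λ x → low D (count (λ u → edge w ω u (lookup x u)))) ≤ H
  few-low-rows D ℓ h w ω = subst (λ x → 2 ^ ℓ * x ≤ H) (≡-sym (∑-vecs-count Θs n (edge w ω) (low D)))
    (*-cancelˡ-≤ (2 ^ D * 2 ^ n) {{m*n≢0 (2 ^ D) (2 ^ n) {{m^n≢0 2 D}} {{m^n≢0 2 n}}}} (begin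
      2 ^ D * 2 ^ n * (2 ^ ℓ * Zlow)        ≡⟨ r₁ (2 ^ D) (2 ^ n) (2 ^ ℓ) Zlow ⟩
      2 ^ D * 2 ^ ℓ * (Zlow * 2 ^ n)        ≤⟨ *-mono-≤ (≤-reflexive (≡-sym (^-distribˡ-+-* 2 D ℓ))) (Z-low Q weight D weight≤Q) ⟩
      2 ^ (D + ℓ) * (2 ^ D * ∏ (λ u → 2 * Q ∸ weight u)) ≤⟨ *-monoʳ-≤ (2 ^ (D + ℓ)) (*-monoʳ-≤ (2 ^ D) (∏-mono miss≤)) ⟩
      2 ^ (D + ℓ) * (2 ^ D * X)             ≡⟨ r₂ (2 ^ (D + ℓ)) (2 ^ D) X ⟩
      2 ^ D * (2 ^ (D + ℓ) * X)             ≤⟨ *-monoʳ-≤ (2 ^ D) contract ⟩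
      2 ^ D * (2 * Q) ^ n                   ≡⟨ cong (2 ^ D *_) (^-distribʳ-* n 2 Q) ⟩
      2 ^ D * (2 ^ n * H)                   ≡⟨ ≡-sym (*-assoc (2 ^ D) (2 ^ n) H) ⟩
      2 ^ D * 2 ^ n * H                     ∎))
    where
    open ≤-Reasoning
    weight : Fin n → ℕ
    weight u = ∑ Θs (λ θ → ⟦ edge w ω u θ ⟧)
    Zlow = Z Q weight (low D)
    other : Fin n → Bool
    other u = not ⌊ u ≟ᶠ w ⌋
    X = ∏ (λ u → if other u then 2 * Q ∸ 1 else 2 * Q)
    weight≤Q : ∀ u → weight u ≤ Q
    weight≤Q u = ≤-trans (∑-mono Θs (λ θ → ⟦⟧≤1 (edge w ω u θ))) (≤-reflexive (≡-sym (length≡∑1 Θs)))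
    miss≤ : ∀ u → 2 * Q ∸ weight u ≤ (if other u then 2 * Q ∸ 1 else 2 * Q)
    miss≤ u rewrite edge-count w ω u | ⌊≟⌋-sym w u with u ≟ᶠ w
    ... | yes _ = ≤-refl
    ... | no _  = ∸-monoʳ-≤ (2 * Q) (m^n>0 2 (d w + d u))
    1≤2Q : 1 ≤ 2 * Q
    1≤2Q = ≤-trans (>-nonZero⁻¹ Q) (m≤m+n Q _)
    half : 2 * (2 * Q ∸ 1) ^ (2 * Q) ≤ (2 * Q) ^ (2 * Q)
    half = subst (λ q → 2 * (2 * Q ∸ 1) ^ (2 * Q) ≤ q ^ (2 * Q)) (m∸n+n≡m 1≤2Q)
      (halving (2 * Q ∸ 1) 1 (2 * Q) {{m*n≢0 2 Q}} (≤-trans (m∸n≤m (2 * Q) 1) (≤-reflexive (≡-sym (*-identityʳ (2 * Q))))))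
    others : suc (count other) ≡ n
    others = trans (cong (_+ count other) (≡-sym (count-single w))) (count-not (λ u → ⌊ u ≟ᶠ w ⌋))
    contract : 2 ^ (D + ℓ) * X ≤ (2 * Q) ^ n
    contract = ∏-if-contract other 2 (2 * Q ∸ 1) (2 * Q) (2 * Q) (D + ℓ) (m∸n≤m (2 * Q) 1) half
      (s≤s⁻¹ (≤-trans h (≤-reflexive (≡-sym others))))
    r₁ : ∀ a b c z → a * b * (c * z) ≡ a * c * (z * b)
    r₁ = solve-∀
    r₂ : ∀ a b c → a * (b * c) ≡ b * (a * c)
    r₂ = solve-∀

  few-hasLowDegree : ∀ D ℓ → suc ((D + ℓ) * (2 * Q)) ≤ n → ∀ w →
    2 ^ ℓ * ∑ (vecs Rows n) (hasLowDegree D w) ≤ H ^ n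
  few-hasLowDegree D ℓ h w = begin
    2 ^ ℓ * ∑ (vecs Rows n) (hasLowDegree D w)
      ≤⟨ *-monoʳ-≤ (2 ^ ℓ) (∑-resample row₀ Rows n others (lowDegree D w) (λ v → if at v then B else H) dep on off) ⟩
    2 ^ ℓ * ∏ (λ v → if at v then B else H)
      ≡⟨ cong (_* ∏ (λ v → if at v then B else H)) (≡-sym (*-identityʳ (2 ^ ℓ))) ⟩
    (2 ^ ℓ) ^ 1 * ∏ (λ v → if at v then B else H)
      -- A single block of length 1, namely the factor at `w`, carries the whole gain `2 ^ ℓ`.
      ≤⟨ ∏-if-contract at (2 ^ ℓ) B H 1 1 B≤H contract (≤-reflexive (≡-sym (count-single w))) ⟩
    H ^ n ∎
    where
    open ≤-Reasoning
    at others : Fin n → Bool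
    at v = ⌊ v ≟ᶠ w ⌋
    others v = not (at v)
    b : Fin n → ℕ
    b u = if ⌊ w ≟ᶠ u ⌋ then 0 else 2 ^ (d w + d u)
    B = Z Q b (low D)
    B≡ : ∀ ω → ∑ Rows (λ x → low D (count (λ u → edge w ω u (lookup x u)))) ≡ B
    B≡ ω = trans (∑-vecs-count Θs n (edge w ω) (low D)) (Z-cong Q (low D) (edge-count w ω))
    2^ℓ*B≤H : 2 ^ ℓ * B ≤ H
    2^ℓ*B≤H = subst (λ x → 2 ^ ℓ * x ≤ H) (B≡ (tabulate (λ _ → row₀))) (few-low-rows D ℓ h w (tabulate (λ _ → row₀)))
    B≤H : B ≤ H
    B≤H = ≤-trans (m≤n*m B (2 ^ ℓ) {{m^n≢0 2 ℓ}}) 2^ℓ*B≤H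
    contract : 2 ^ ℓ * B ^ 1 ≤ H ^ 1
    contract = ≤-trans (≤-reflexive (cong (2 ^ ℓ *_) (*-identityʳ B))) (≤-trans 2^ℓ*B≤H (≤-reflexive (≡-sym (*-identityʳ H))))
    dep : ∀ v x → DependsOn others (lowDegree D w v x)
    dep v x ω ω′ e with v ≟ᶠ w
    ... | no _ = refl
    ... | yes refl = cong (low D) (count-cong same)
      where
      same : ∀ u → edge v ω u (lookup x u) ≡ edge v ω′ u (lookup x u)
      same u with v ≟ᶠ u
      ... | yes _ = refl
      ... | no v≢u = cong (λ row → agree (d v + d u) (lookup x u) (lookup row v)) (e u (other u v≢u))
        where
        other : ∀ u → ¬ v ≡ u → not ⌊ u ≟ᶠ v ⌋ ≡ true
        other u v≢u with u ≟ᶠ v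
        ... | yes p = contradiction (≡-sym p) v≢u
        ... | no _  = refl
    on : ∀ v → others v ≡ true → (∀ x ω → lowDegree D w v x ω ≤ 1) × length Rows ≤ (if at v then B else H)
    on v _ with v ≟ᶠ w
    ... | no _ = (λ _ _ → ≤-refl) , ≤-reflexive |Rows|
    off : ∀ v → others v ≡ false → ∀ ω → ∑ Rows (λ x → lowDegree D w v x ω) ≤ (if at v then B else H)
    off v _ ω with v ≟ᶠ w
    ... | yes refl = ≤-reflexive (B≡ ω)

  -- Existence of the graph.

  not-conflict-free : ∀ ω (c : Fin n → Fin k) (p : PartialColouring c (3 * Q)) →
    Against.undefeated (PartialColouring.σ p) ω ≡ 0 → ¬ IsCFCN (graph ω) c
  not-conflict-free ω c p e cf = Against.unseen-colour σ ω c v j (proj₁ (proj₂ survivor))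
    (1≤∏ (λ i → avoids (Against.isBig σ i) (Against.seen σ v ω i (lookup ω v))) (proj₂ (proj₂ survivor)) j)
    (class⊆ j) (class j) (proj₂ (cf v))
    where
    open PartialColouring p
    survivor = Against.survivor σ ω e
    v = proj₁ survivor
    j = proj₁ (cf v)

  hasLowDegree≡0 : ∀ D w ω → hasLowDegree D w ω ≡ 0 → D ≤ deg (graph ω) w
  hasLowDegree≡0 D w ω e with ∏≡0⇒∃0 (λ v → lowDegree D w v (lookup ω v) ω) e
  ... | v , e′ with v ≟ᶠ w
  ... | yes refl = low≡0 D _ e′

  -- Hypothesis `hz` pays for the union over truncated colourings and `hℓ` for the union over
  -- vertices. Each union has probability at most 1/4, so some `ω` defeats every truncated colouring
  -- and has no vertex of low degree.
  exists-graph : ∀ N D ℓ z → (∀ e → N ≤ count (λ v → ⌊ level v ≟ᶠ e ⌋)) →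
    k * (3 * Q) + z * Y ≤ N → 4 * (1 + n * k) ^ (k * (3 * Q)) ≤ 2 ^ z →
    suc ((D + ℓ) * (2 * Q)) ≤ n → 4 * n ≤ 2 ^ ℓ →
    ∃ λ (G : Graph n) → (∀ v → D ≤ deg G v) × (∀ (c : Fin n → Fin k) → ¬ IsCFCN G c)
  exists-graph N D ℓ z N≤ hN hz hD hℓ = graph ω , degrees , λ c → not-conflict-free ω c (truncateColouring c (3 * Q)) (defeated (truncateColouring c (3 * Q)))
    where
    open ≤-Reasoning
    m = k * (3 * Q)
    Ω = vecs Rows n
    Σs = vecs (allFin (suc k)) n
    small : Vec (Fin (suc k)) n → ℕ
    small σ = ⟦ supportSize σ ≤ᵇ m ⟧
    surviving lowest : Vec Row n → ℕ
    surviving ω = ∑ Σs (λ σ → small σ * Against.undefeated σ ω)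
    lowest ω = ∑ (allFin n) (λ w → 1 * hasLowDegree D w ω)
    n≢0 : NonZero n
    n≢0 = >-nonZero (≤-trans (s≤s z≤n) hD)

    each : ∀ σ → 2 ^ z * (small σ * ∑ Ω (Against.undefeated σ)) ≤ small σ * H ^ n
    each σ = by-size (supportSize σ ≤ᵇ m) refl
      where
      by-size : ∀ x → (supportSize σ ≤ᵇ m) ≡ x → 2 ^ z * (⟦ x ⟧ * ∑ Ω (Against.undefeated σ)) ≤ ⟦ x ⟧ * H ^ n
      by-size false _  = ≤-reflexive (*-zeroʳ (2 ^ z))
      by-size true  le = begin
        2 ^ z * (1 * ∑ Ω (Against.undefeated σ))  ≡⟨ cong (2 ^ z *_) (+-identityʳ _) ⟩
        2 ^ z * ∑ Ω (Against.undefeated σ)        ≤⟨ Against.few-undefeated σ m N z (≤ᵇ⇒≤ (supportSize σ) m (subst T (≡-sym le) _)) hN N≤ ⟩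
        H ^ n                                     ≡⟨ ≡-sym (+-identityʳ _) ⟩
        1 * H ^ n                                 ∎

    4*surviving : 4 * ∑ Ω surviving ≤ H ^ n
    4*surviving = union-bound Ω Σs small (λ σ → Against.undefeated σ) (2 ^ z) ((1 + n * k) ^ m) {{m^n≢0 (1 + n * k) m}}
      each (smallSupports k n m) hz

    4*lowest : 4 * ∑ Ω lowest ≤ H ^ n
    4*lowest = union-bound Ω (allFin n) (λ _ → 1) (hasLowDegree D) (2 ^ ℓ) n {{n≢0}}
      (λ w → ≤-trans (≤-reflexive (cong (2 ^ ℓ *_) (+-identityʳ _)))
        (≤-trans (few-hasLowDegree D ℓ hD w) (≤-reflexive (≡-sym (+-identityʳ _)))))
      (≤-reflexive (∑-allFin-one n)) hℓ

    |Ω| : length Ω ≡ H ^ n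
    |Ω| = trans (length-vecs Rows n) (cong (_^ n) |Rows|)

    few : ∑ Ω (λ ω → surviving ω + lowest ω) < length Ω
    few = quarters Ω surviving lowest (H ^ n) (m^n>0 H n) |Ω| 4*surviving 4*lowest

    chosen : ∃ λ ω → surviving ω + lowest ω ≡ 0
    chosen = ∑<length⇒∃0 Ω _ few
    ω = proj₁ chosen

    defeated : ∀ {c} (p : PartialColouring c (3 * Q)) → Against.undefeated (PartialColouring.σ p) ω ≡ 0
    defeated p = n≤0⇒n≡0 (begin
      Against.undefeated σ ω                ≡⟨ ≡-sym (+-identityʳ _) ⟩
      1 * Against.undefeated σ ω            ≡⟨ cong (λ x → ⟦ x ⟧ * Against.undefeated σ ω) (≡-sym (T⇒≡true (≤⇒≤ᵇ support))) ⟩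
      small σ * Against.undefeated σ ω      ≤⟨ term≤∑-vecs n (λ σ → small σ * Against.undefeated σ ω) σ ⟩
      surviving ω                           ≡⟨ m+n≡0⇒m≡0 (surviving ω) (proj₂ chosen) ⟩
      0                                     ∎)
      where open PartialColouring p using (σ; support)

    degrees : ∀ w → D ≤ deg (graph ω) w
    degrees w = hasLowDegree≡0 D w ω (n≤0⇒n≡0 (begin
      hasLowDegree D w ω           ≡⟨ ≡-sym (+-identityʳ _) ⟩
      1 * hasLowDegree D w ω       ≤⟨ term≤∑ (λ w → 1 * hasLowDegree D w ω) w ⟩
      lowest ω                     ≡⟨ m+n≡0⇒n≡0 (surviving ω) (proj₂ chosen) ⟩
      0                            ∎))

-- Bit vectors, degrees and chromatic numbers

bits : List Bool
bits = true ∷ false ∷ []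

xnor : Bool → Bool → Bool
xnor true  y = y
xnor false y = not y

xnor-sym : ∀ x y → xnor x y ≡ xnor y x
xnor-sym true  true  = refl
xnor-sym true  false = refl
xnor-sym false true  = refl
xnor-sym false false = refl

-- Skipping the first `e` bits leaves `e` bits free, so `2 ^ e` vectors agree with a given one when
-- `e ≤ M`.
agree : ∀ {M} → ℕ → Vec Bool M → Vec Bool M → Bool
agree e       []       []       = true
agree zero    (x ∷ xs) (y ∷ ys) = xnor x y ∧ agree zero xs ys
agree (suc e) (x ∷ xs) (y ∷ ys) = agree e xs ys

agree-sym : ∀ {M} e (x y : Vec Bool M) → agree e x y ≡ agree e y x
agree-sym e       []       []       = refl
agree-sym zero    (x ∷ xs) (y ∷ ys) = cong₂ _∧_ (xnor-sym x y) (agree-sym zero xs ys)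
agree-sym (suc e) (x ∷ xs) (y ∷ ys) = agree-sym e xs ys

agree-count : ∀ {M} e → e ≤ M → ∀ (y : Vec Bool M) → ∑ (vecs bits M) (λ x → ⟦ agree e x y ⟧) ≡ 2 ^ e
agree-count {zero}  zero    _ []       = refl
agree-count {suc M} zero    _ (true ∷ y)  = trans (∑-vecs bits M _)
  (trans (cong₂ _+_ (agree-count zero z≤n y) (+-identityʳ _)) (cong suc (∑-zero (vecs bits M))))
agree-count {suc M} zero    _ (false ∷ y) = trans (∑-vecs bits M _)
  (cong₂ _+_ (∑-zero (vecs bits M)) (trans (+-identityʳ _) (agree-count zero z≤n y)))
agree-count {suc M} (suc e) (s≤s h) (y₀ ∷ y) = trans (∑-vecs bits M _)
  (cong (λ x → x + (x + 0)) (agree-count e h y))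

∑-allFin-split : ∀ m n (f : Fin (m + n) → ℕ) →
  ∑ (allFin (m + n)) f ≡ ∑ (allFin m) (λ i → f (i ↑ˡ n)) + ∑ (allFin n) (λ i → f (m ↑ʳ i))
∑-allFin-split zero    n f = refl
∑-allFin-split (suc m) n f = begin
  ∑ (allFin (suc m + n)) f
    ≡⟨ ∑-allFin (m + n) f ⟩
  f zero + ∑ (allFin (m + n)) (f ∘ suc)
    ≡⟨ cong (f zero +_) (∑-allFin-split m n (f ∘ suc)) ⟩
  f zero + (∑ (allFin m) (λ i → f (suc i ↑ˡ n)) + ∑ (allFin n) (λ i → f (suc m ↑ʳ i)))
    ≡⟨ ≡-sym (+-assoc (f zero) _ _) ⟩
  f zero + ∑ (allFin m) (λ i → f (suc i ↑ˡ n)) + ∑ (allFin n) (λ i → f (suc m ↑ʳ i))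
    ≡⟨ cong (_+ ∑ (allFin n) (λ i → f (suc m ↑ʳ i))) (≡-sym (∑-allFin m (λ i → f (i ↑ˡ n)))) ⟩
  ∑ (allFin (suc m)) (λ i → f (i ↑ˡ n)) + ∑ (allFin n) (λ i → f (suc m ↑ʳ i)) ∎
  where open ≡-Reasoning

-- `quotient N` cuts the vertices into `t` consecutive blocks of size `N`, which serve as the
-- levels.
quotient-fibre : ∀ t N e → N ≤ count (λ v → ⌊ quotient {t} N v ≟ᶠ e ⌋)
quotient-fibre (suc t) N zero = begin
  N                                                   ≡⟨ ≡-sym (∑-allFin-one N) ⟩
  ∑ (allFin N) (λ _ → 1)                              ≡⟨ ∑-cong (allFin N) first ⟩
  ∑ (allFin N) (λ i → f (i ↑ˡ (t * N)))               ≤⟨ m≤m+n _ _ ⟩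
  ∑ (allFin N) (λ i → f (i ↑ˡ (t * N))) + _           ≡⟨ ≡-sym (∑-allFin-split N (t * N) f) ⟩
  ∑ (allFin (N + t * N)) f                            ∎
  where
  open ≤-Reasoning
  f : Fin (suc t * N) → ℕ
  f v = ⟦ ⌊ quotient {suc t} N v ≟ᶠ zero ⌋ ⟧
  first : ∀ i → 1 ≡ f (i ↑ˡ (t * N))
  first i rewrite splitAt-↑ˡ N i (t * N) = refl
quotient-fibre (suc t) N (suc e) = begin
  N                                                   ≤⟨ quotient-fibre t N e ⟩
  ∑ (allFin (t * N)) (λ i → ⟦ ⌊ quotient {t} N i ≟ᶠ e ⌋ ⟧) ≡⟨ ∑-cong (allFin (t * N)) later ⟩
  ∑ (allFin (t * N)) (λ i → f (N ↑ʳ i))               ≤⟨ m≤n+m _ (∑ (allFin N) (λ i → f (i ↑ˡ (t * N)))) ⟩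
  _ + ∑ (allFin (t * N)) (λ i → f (N ↑ʳ i))           ≡⟨ ≡-sym (∑-allFin-split N (t * N) f) ⟩
  ∑ (allFin (N + t * N)) f                            ∎
  where
  open ≤-Reasoning
  f : Fin (suc t * N) → ℕ
  f v = ⟦ ⌊ quotient {suc t} N v ≟ᶠ suc e ⌋ ⟧
  later : ∀ i → ⟦ ⌊ quotient {t} N i ≟ᶠ e ⌋ ⟧ ≡ f (N ↑ʳ i)
  later i rewrite splitAt-↑ʳ N (t * N) i = cong ⟦_⟧ (≡-sym (⌊≟⌋-suc (quotient {t} N i) e))

max-allFin : ∀ n (f : Fin (suc n) → ℕ) →
  foldr _⊔_ 0 (map f (allFin (suc n))) ≡ f zero ⊔ foldr _⊔_ 0 (map (f ∘ suc) (allFin n))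
max-allFin n f = cong (λ xs → f zero ⊔ foldr _⊔_ 0 xs) (trans (map-tabulate suc f) (≡-sym (map-tabulate (λ i → i) (f ∘ suc))))

max-≤ : ∀ n (f : Fin n → ℕ) x → (∀ v → f v ≤ x) → foldr _⊔_ 0 (map f (allFin n)) ≤ x
max-≤ zero    f x h = z≤n
max-≤ (suc n) f x h = ≤-trans (≤-reflexive (max-allFin n f)) (⊔-lub (h zero) (max-≤ n (f ∘ suc) x (h ∘ suc)))

deg≤ : ∀ {n} (G : Graph n) v → deg G v ≤ n
deg≤ {n} G v = ≤-trans (∑-mono (allFin n) (λ u → ⟦⟧≤1 (adj G v u))) (≤-reflexive (∑-allFin-one n))

maxDeg≤ : ∀ {n} (G : Graph n) → maxDeg G ≤ n
maxDeg≤ {n} G = max-≤ n (deg G) n (deg≤ G)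

deg≤maxDeg : ∀ {n} (G : Graph (suc n)) → deg G zero ≤ maxDeg G
deg≤maxDeg {n} G = ≤-trans (m≤m⊔n (deg G zero) _) (≤-reflexive (≡-sym (max-allFin n (deg G))))

-- The least number of colours.

least : ∀ {P : ℕ → Set} → (∀ k → Dec (P k)) → ∀ n → P n → ∃ λ k → P k × (∀ k′ → k′ < k → ¬ P k′)
least {P} P? n p = search n zero (+-identityʳ n) λ _ ()
  where
  search : ∀ fuel k → fuel + k ≡ n → (∀ k′ → k′ < k → ¬ P k′) → ∃ λ k → P k × (∀ k′ → k′ < k → ¬ P k′)
  search zero       k refl below = k , p , below
  search (suc fuel) k eq   below with P? k
  ... | yes q = k , q , below
  ... | no ¬q = search fuel (suc k) (trans (+-suc fuel k) eq) extend
    where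
    extend : ∀ k′ → k′ < suc k → ¬ P k′
    extend k′ lt with m≤n⇒m<n∨m≡n (s≤s⁻¹ lt)
    ... | inj₁ k′<k = below k′ k′<k
    ... | inj₂ refl = ¬q

-- Needed to enumerate colourings as elements of `Fin (k ^ n)`: decoding an encoded colouring
-- returns it only pointwise.
IsCFCN-cong : ∀ {n k} {G : Graph n} {c c′ : Fin n → Fin k} → (∀ u → c u ≡ c′ u) → IsCFCN G c → IsCFCN G c′
IsCFCN-cong {G = G} e h v with h v
... | j , one = j , trans (count-cong (λ u → cong (λ x → inClosedNbhd G v u ∧ ⌊ x ≟ᶠ j ⌋) (≡-sym (e u)))) one

cfcn? : ∀ {n} (G : Graph n) k → Dec (Σ (Fin n → Fin k) (IsCFCN G))
cfcn? {n} G k = map′ (λ (i , h) → finToFun i , h)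
  (λ (c , h) → funToFin c , IsCFCN-cong {G = G} (λ u → ≡-sym (finToFun-funToFin c u)) h)
  (any? λ (i : Fin (k ^ n)) → all? λ v → any? λ j → _ ≟ 1)

cfcn-id : ∀ {n} (G : Graph n) → IsCFCN G (λ v → v)
cfcn-id G v = v , trans (count-cong own) (count-single v)
  where
  own : ∀ u → inClosedNbhd G v u ∧ ⌊ u ≟ᶠ v ⌋ ≡ ⌊ u ≟ᶠ v ⌋
  own u with u ≟ᶠ v
  ... | yes _ = refl
  ... | no _  = ∧-zeroʳ (adj G v u)

cfcn-inject : ∀ {n k k′} (G : Graph n) (k′≤k : k′ ≤ k) {c : Fin n → Fin k′} →
  IsCFCN G c → IsCFCN G (λ u → inject≤ (c u) k′≤k)
cfcn-inject G k′≤k {c} h v with h v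
... | j , one = inject≤ j k′≤k , trans (count-cong (λ u → cong (inClosedNbhd G v u ∧_) (preserved u))) one
  where
  preserved : ∀ u → ⌊ inject≤ (c u) k′≤k ≟ᶠ inject≤ j k′≤k ⌋ ≡ ⌊ c u ≟ᶠ j ⌋
  preserved u with inject≤ (c u) k′≤k ≟ᶠ inject≤ j k′≤k | c u ≟ᶠ j
  ... | yes _ | yes _ = refl
  ... | no _  | no _  = refl
  ... | yes p | no ¬q = contradiction (inject≤-injective k′≤k k′≤k (c u) j p) ¬q
  ... | no ¬p | yes q = contradiction (cong (λ i → inject≤ i k′≤k) q) ¬p

-- The minimum exists because giving all vertices distinct colours works; it exceeds `k` because a
-- colouring with fewer colours embeds into `k` by `inject≤`.
chiCN> : ∀ {n} (G : Graph n) k → (∀ (c : Fin n → Fin k) → ¬ IsCFCN G c) → ∃ λ χ → IsChiCN G χ × k < χ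
chiCN> {n} G k none with least (cfcn? G) n ((λ v → v) , cfcn-id G)
... | χ , col , below with χ ≤? k
... | yes χ≤k = contradiction (cfcn-inject G χ≤k (proj₂ col)) (none _)
... | no χ≰k = χ , (col , below) , ≰⇒> χ≰k

-- Choice of parameters

n≤2^n : ∀ n → n ≤ 2 ^ n
n≤2^n zero    = z≤n
n≤2^n (suc n) = +-mono-≤ (m^n>0 2 n) (≤-trans (n≤2^n n) (≤-reflexive (≡-sym (+-identityʳ _))))

-- Sizes are measured in powers `P e` of 2 ^ t: the degree bound is `P x`, the order at most
-- `P (5 + x)`, and `2 ^ ℓ` is `P (8 + x)`. Factors such as `t` and 2 are absorbed into `P 1`.
module Parameters (s x : ℕ) (12≤x : 12 ≤ x) (large : 8 + x ≤ suc s) where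
  open ≤-Reasoning

  t Θ-bits N order k Q m ℓ z : ℕ
  t = suc s
  Θ-bits = suc (2 * s)

  P : ℕ → ℕ
  P e = 2 ^ (e * t)

  N = P (4 + x)
  order = t * N
  k = t * t
  Q = length (vecs bits Θ-bits)
  m = k * (3 * Q)
  ℓ = (8 + x) * t
  z = 2 + ℓ * m

  P-* : ∀ e f → P e * P f ≡ P (e + f)
  P-* e f = trans (≡-sym (^-distribˡ-+-* 2 (e * t) (f * t))) (cong (2 ^_) (≡-sym (*-distribʳ-+ t e f)))

  P-mono : ∀ {e f} → e ≤ f → P e ≤ P f
  P-mono h = ^-monoʳ-≤ 2 (*-monoˡ-≤ t h)

  P>0 : ∀ e → 1 ≤ P e
  P>0 e = m^n>0 2 (e * t)

  t≤P1 : t ≤ P 1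
  t≤P1 = ≤-trans (n≤2^n t) (≤-reflexive (cong (2 ^_) (≡-sym (*-identityˡ t))))

  2≤P1 : 2 ≤ P 1
  2≤P1 = ^-monoʳ-≤ 2 {1} {1 * t} (s≤s z≤n)

  P-double : ∀ e → P e + P e ≤ P (1 + e)
  P-double e = begin
    P e + P e        ≡⟨ cong (P e +_) (≡-sym (+-identityʳ (P e))) ⟩
    2 * P e          ≤⟨ *-monoˡ-≤ (P e) 2≤P1 ⟩
    P 1 * P e        ≡⟨ P-* 1 e ⟩
    P (1 + e)        ∎

  |Θ| : Q ≡ 2 ^ suc (2 * s)
  |Θ| = length-vecs bits Θ-bits

  2*Q : 2 * Q ≡ P 2
  2*Q = trans (cong (2 *_) |Θ|) (cong (2 ^_) (r s))
    where
    r : ∀ s → 2 + 2 * s ≡ 2 * (1 + s)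
    r = solve-∀

  k≤P2 : k ≤ P 2
  k≤P2 = ≤-trans (*-mono-≤ t≤P1 t≤P1) (≤-reflexive (P-* 1 1))

  m≤P5 : m ≤ P 5
  m≤P5 = begin
    k * (3 * Q)            ≤⟨ *-mono-≤ k≤P2 (m≤m+n (3 * Q) Q) ⟩
    P 2 * (3 * Q + Q)      ≡⟨ cong (P 2 *_) (r Q) ⟩
    P 2 * (2 * Q + 2 * Q)  ≡⟨ cong (λ y → P 2 * (y + y)) 2*Q ⟩
    P 2 * (P 2 + P 2)      ≤⟨ *-monoʳ-≤ (P 2) (P-double 2) ⟩
    P 2 * P 3              ≡⟨ P-* 2 3 ⟩
    P 5                    ∎
    where
    r : ∀ q → 3 * q + q ≡ 2 * q + 2 * q
    r = solve-∀

  ℓ≤P2 : ℓ ≤ P 2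
  ℓ≤P2 = ≤-trans (*-monoˡ-≤ t large) k≤P2

  z≤P8 : z ≤ P 8
  z≤P8 = begin
    2 + ℓ * m       ≤⟨ +-mono-≤ (≤-trans 2≤P1 (P-mono {1} {7} (s≤s z≤n))) (*-mono-≤ ℓ≤P2 m≤P5) ⟩
    P 7 + P 2 * P 5 ≡⟨ cong (P 7 +_) (P-* 2 5) ⟩
    P 7 + P 7       ≤⟨ P-double 7 ⟩
    P 8             ∎

  -- The requirement of `P 16` vertices per level is the origin of `12 ≤ x`.
  room : m + z * P 7 ≤ N
  room = begin
    m + z * P 7       ≤⟨ +-mono-≤ (≤-trans m≤P5 (P-mono {5} {15} (m≤m+n 5 10))) (*-monoˡ-≤ (P 7) z≤P8) ⟩
    P 15 + P 8 * P 7  ≡⟨ cong (P 15 +_) (P-* 8 7) ⟩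
    P 15 + P 15       ≤⟨ P-double 15 ⟩
    P 16              ≤⟨ P-mono (+-monoʳ-≤ 4 12≤x) ⟩
    N                 ∎

  order≤ : order ≤ P (5 + x)
  order≤ = ≤-trans (*-monoˡ-≤ N t≤P1) (≤-reflexive (P-* 1 (4 + x)))

  -- Each of the `m` slots has at most `2 ^ ℓ` contents; the summand 2 in `z` pays for the factor 4.
  families : 4 * (1 + order * k) ^ m ≤ 2 ^ z
  families = begin
    4 * (1 + order * k) ^ m     ≤⟨ *-monoʳ-≤ 4 (^-monoˡ-≤ m base) ⟩
    4 * (2 ^ ℓ) ^ m         ≡⟨ cong (4 *_) (^-*-assoc 2 ℓ m) ⟩
    4 * 2 ^ (ℓ * m)         ≡⟨ ≡-sym (^-distribˡ-+-* 2 2 (ℓ * m)) ⟩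
    2 ^ z                   ∎
    where
    base : 1 + order * k ≤ P (8 + x)
    base = begin
      1 + order * k             ≤⟨ +-mono-≤ (P>0 (7 + x)) (*-mono-≤ order≤ k≤P2) ⟩
      P (7 + x) + P (5 + x) * P 2 ≡⟨ cong (P (7 + x) +_) (trans (*-comm (P (5 + x)) (P 2)) (P-* 2 (5 + x))) ⟩
      P (7 + x) + P (7 + x) ≤⟨ P-double (7 + x) ⟩
      P (8 + x)             ∎

  vertices : 4 * order ≤ 2 ^ ℓ
  vertices = begin
    4 * order                   ≤⟨ *-mono-≤ (*-mono-≤ 2≤P1 2≤P1) order≤ ⟩
    P 1 * P 1 * P (5 + x)   ≡⟨ cong (_* P (5 + x)) (P-* 1 1) ⟩
    P 2 * P (5 + x)         ≡⟨ P-* 2 (5 + x) ⟩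
    P (7 + x)               ≤⟨ P-mono (n≤1+n (7 + x)) ⟩
    P (8 + x)               ∎

  degree-room : suc ((P x + ℓ) * (2 * Q)) ≤ order
  degree-room = begin
    suc ((P x + ℓ) * (2 * Q))      ≡⟨ cong (λ q → suc ((P x + ℓ) * q)) 2*Q ⟩
    suc ((P x + ℓ) * P 2)          ≤⟨ +-mono-≤ (P>0 (3 + x)) (*-monoˡ-≤ (P 2) (+-monoʳ-≤ (P x) (≤-trans ℓ≤P2 (P-mono (≤-trans (m≤m+n 2 10) 12≤x))))) ⟩
    P (3 + x) + (P x + P x) * P 2  ≤⟨ +-monoʳ-≤ (P (3 + x)) (*-monoˡ-≤ (P 2) (P-double x)) ⟩
    P (3 + x) + P (1 + x) * P 2    ≡⟨ cong (P (3 + x) +_) (trans (*-comm (P (1 + x)) (P 2)) (P-* 2 (1 + x))) ⟩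
    P (3 + x) + P (3 + x)          ≤⟨ P-double (3 + x) ⟩
    N                              ≤⟨ m≤n*m N t ⟩
    order                              ∎

  128^k : 128 ^ k ≡ P 7 ^ t
  128^k = trans (^-*-assoc 2 7 k) (trans (cong (2 ^_) (≡-sym (*-assoc 7 t t))) (≡-sym (^-*-assoc 2 (7 * t) t)))

  HardGraph : ℕ → Set
  HardGraph j = ∃ λ (G : Graph j) → (∀ v → P x ≤ deg G v) × (∀ (c : Fin j → Fin k) → ¬ IsCFCN G c)

  hard-graph : HardGraph order
  hard-graph = RandomGraph.exists-graph (vecs bits Θ-bits) (replicate Θ-bits true) agree agree-sym
    s (λ e e≤2s → agree-count e (m≤n⇒m≤1+n e≤2s)) |Θ| k (P 7) {{m^n≢0 2 (7 * t)}} 128^k (quotient {t} N)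
    N (P x) ℓ z (quotient-fibre t N) room families degree-room vertices

  nonempty-hard-graph : ∃ λ n′ → suc n′ ≡ order × HardGraph (suc n′)
  nonempty-hard-graph = nonempty order (≤-trans (s≤s z≤n) degree-room) hard-graph
    where
    -- Replacing `order` by a variable permits the case split that exhibits it as a successor.
    nonempty : ∀ j → 0 < j → HardGraph j → ∃ λ n′ → suc n′ ≡ j × HardGraph (suc n′)
    nonempty (suc n′) _ g = n′ , refl , g

  -- Order and degree bound differ by 2 ^ (5t), so (5 + x) b ≤ x (b + 1) is required, which is
  -- `5 * b ≤ x`.
  powers : ∀ b {Δ δ} → 5 * b ≤ x → Δ ≤ P (5 + x) → P x ≤ δ → Δ ^ b ≤ δ ^ suc b
  powers b {Δ} {δ} h Δ≤ ≤δ = begin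
    Δ ^ b                 ≤⟨ ^-monoˡ-≤ b Δ≤ ⟩
    P (5 + x) ^ b         ≡⟨ ^-*-assoc 2 ((5 + x) * t) b ⟩
    2 ^ ((5 + x) * t * b) ≤⟨ ^-monoʳ-≤ 2 exponents ⟩
    2 ^ (x * t * suc b)   ≡⟨ ≡-sym (^-*-assoc 2 (x * t) (suc b)) ⟩
    P x ^ suc b           ≤⟨ ^-monoˡ-≤ (suc b) ≤δ ⟩
    δ ^ suc b             ∎
    where
    r₁ : ∀ x t b → (5 + x) * t * b ≡ t * (5 * b + x * b)
    r₁ = solve-∀
    r₂ : ∀ x t b → t * (x + x * b) ≡ x * t * (1 + b)
    r₂ = solve-∀
    exponents : (5 + x) * t * b ≤ x * t * suc b
    exponents = begin
      (5 + x) * t * b     ≡⟨ r₁ x t b ⟩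
      t * (5 * b + x * b) ≤⟨ *-monoʳ-≤ t (+-monoˡ-≤ (x * b) h) ⟩
      t * (x + x * b)     ≡⟨ r₂ x t b ⟩
      x * t * suc b       ∎

  log-squared : ∀ {Δ χ} → Δ ≤ P (5 + x) → k < χ → ⌊log₂ Δ ⌋ * ⌊log₂ Δ ⌋ ≤ (5 + x) * (5 + x) * χ
  log-squared {Δ} {χ} Δ≤ k<χ = begin
    ⌊log₂ Δ ⌋ * ⌊log₂ Δ ⌋           ≤⟨ *-mono-≤ log≤ log≤ ⟩
    ((5 + x) * t) * ((5 + x) * t)   ≡⟨ *-interchange (5 + x) t (5 + x) t ⟩
    (5 + x) * (5 + x) * k           ≤⟨ *-monoʳ-≤ ((5 + x) * (5 + x)) (<⇒≤ k<χ) ⟩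
    (5 + x) * (5 + x) * χ           ∎
    where
    log≤ : ⌊log₂ Δ ⌋ ≤ (5 + x) * t
    log≤ = ≤-trans (⌊log₂⌋-mono-≤ Δ≤) (≤-reflexive (⌊log₂[2^n]⌋≡n ((5 + x) * t)))

  conclusion : ∀ a b D → 5 * b ≤ x → D ≤ t → (∃ λ n′ → suc n′ ≡ order × HardGraph (suc n′)) →
    Σ ℕ λ n → Σ (Graph (suc n)) λ G →
    D ≤ maxDeg G ×
    ((v : Fin (suc n)) → maxDeg G ^ (b ∸ a) ≤ deg G v ^ suc b) ×
    Σ ℕ λ k → IsChiCN G k × ⌊log₂ maxDeg G ⌋ * ⌊log₂ maxDeg G ⌋ ≤ (5 + x) * (5 + x) * k
  conclusion a b D 5b≤x D≤t (n′ , n≡ , G , degrees , hard) = n′ , G ,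
    ≤-trans D≤t (≤-trans t≤P1 (≤-trans (P-mono (≤-trans (s≤s z≤n) 12≤x)) Px≤Δ)) ,
    -- The bound is proved for exponent `b`; passing down to `b ∸ a` uses that the maximum degree is
    -- positive.
    (λ v → ≤-trans (^-monoʳ-≤ (maxDeg G) {{>-nonZero (≤-trans (P>0 x) Px≤Δ)}} (m∸n≤m b a)) (powers b 5b≤x Δ≤ (degrees v))) ,
    χ-part (chiCN> G k hard)
    where
    Px≤Δ : P x ≤ maxDeg G
    Px≤Δ = ≤-trans (degrees zero) (deg≤maxDeg G)
    Δ≤ : maxDeg G ≤ P (5 + x)
    Δ≤ = ≤-trans (≤-trans (maxDeg≤ G) (≤-reflexive n≡)) order≤
    χ-part : (∃ λ χ → IsChiCN G χ × k < χ) →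
      Σ ℕ λ χ → IsChiCN G χ × ⌊log₂ maxDeg G ⌋ * ⌊log₂ maxDeg G ⌋ ≤ (5 + x) * (5 + x) * χ
    χ-part (χ , isχ , k<χ) = χ , isχ , log-squared Δ≤ k<χ

theorem6 : (a b : ℕ) → 0 < a → 1000 * a < 3 * b →
    Σ ℕ λ m → 1 ≤ m ×
    ((D : ℕ) → Σ ℕ λ n → Σ (Graph (suc n)) λ G →
    D ≤ maxDeg G ×
    ((v : Fin (suc n)) → maxDeg G ^ (b ∸ a) ≤ deg G v ^ b) ×
    Σ ℕ λ k → IsChiCN G k × ⌊log₂ maxDeg G ⌋ * ⌊log₂ maxDeg G ⌋ ≤ m * k)
theorem6 (suc a) (suc b) _ _ = (5 + x) * (5 + x) , s≤s z≤n , λ D →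
  -- This choice of `s` gives both `t ≥ D`, for arbitrarily large degrees, and `t ≥ 8 + x`, for
  -- `ℓ≤P2`.
  let open Parameters (D + (8 + x)) x (m≤m+n 12 (5 * b)) (m≤n⇒m≤1+n (m≤n+m (8 + x) D))
  in conclusion a b D (m≤n+m (5 * b) 12) (m≤n⇒m≤1+n (m≤m+n D (8 + x))) nonempty-hard-graph
  where
  -- The 12 serves `room` and `5 * b` serves `powers`, where `b` is the predecessor of the given
  -- denominator. As `x` does not involve `D`, the constant is the same for all `D`.
  x = 12 + 5 * b
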